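{- Let $G$ be a finite nilpotent group that admits a skew-Hadamard difference set. Then $G$ is a $p$-group for some prime $p$.
   Context: Let $G$ be a finite group of order $v$. A $(v,k,\lambda)$ difference set in $G$ is a subset $D\subseteq G$ of size $k$ such that each non-identity element of $G$ can be written as $d_1d_2^{ -1}$ with $d_1\neq d_2$ in $D$ in exactly $\lambda$ distinct ways. A skew-Hadamard difference set (SHDS) in $G$ is a difference set $D$ such that $G$ is the disjoint union of $D$, $D^{(-1)}$ and $\{1\}$, where $D^{(-1)}=\{d^{ -1}: d\in D\}$. We say that $G$ admits an SHDS if such a $D\subseteq G$ exists. -}

module Defs where

open import Level using (_⊔_) renaming (suc to lsuc)
open import Algebra.Bundles using (Group)
open import Data.Fin.Base using (Fin)
open import Data.Nat.Base using (ℕ; zero; suc; _^_)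
open import Data.Product.Base using (Σ; Σ-syntax; ∃-syntax; _×_; _,_; proj₁)
open import Data.Product.Relation.Binary.Pointwise.NonDependent using (_×ₛ_)
open import Function.Bundles using (Inverse)
open import Relation.Binary.Bundles using (Setoid)
open import Relation.Binary.Definitions using (_Respects_)
import Relation.Binary.Construct.On as On
import Relation.Binary.PropositionalEquality as ≡
open import Relation.Nullary.Negation.Core using (¬_)
open import Relation.Unary using (Pred; _∪_; _⊥_; Universal)

HasSize : ∀ {a ℓ} → Setoid a ℓ → ℕ → Set (a ⊔ ℓ)
HasSize S n = Inverse S (≡.setoid (Fin n))

-- Elements are compared by their first components, so different membership
-- proofs for the same element are not counted separately.
subsetSetoid : ∀ {a ℓ p} (S : Setoid a ℓ) → Pred (Setoid.Carrier S) p →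
               Setoid (a ⊔ p) ℓ
subsetSetoid S P = On.setoid {B = Σ (Setoid.Carrier S) P} S proj₁

module _ {c ℓ} (G : Group c ℓ) where
  open Group G

  HasOrder : ℕ → Set (c ⊔ ℓ)
  HasOrder v = HasSize setoid v

  IsFinite : Set (c ⊔ ℓ)
  IsFinite = ∃[ v ] HasOrder v

  IsFinitePGroup : ℕ → Set (c ⊔ ℓ)
  IsFinitePGroup p = ∃[ n ] HasOrder (p ^ n)

  commutator : Carrier → Carrier → Carrier
  commutator x y = (x ⁻¹ ∙ y ⁻¹) ∙ (x ∙ y)

  -- The upper central series: 1 = Z₀ ≤ Z₁ ≤ …, where Zᵢ₊₁ / Zᵢ is the centre
  -- of G / Zᵢ, i.e. x ∈ Zᵢ₊₁ iff [x , y] ∈ Zᵢ for every y.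
  data UpperCentral : ℕ → Pred Carrier (c ⊔ ℓ) where
    base : ∀ {x} → x ≈ ε → UpperCentral zero x
    step : ∀ {i x} → (∀ y → UpperCentral i (commutator x y)) →
           UpperCentral (suc i) x

  IsNilpotent : Set (c ⊔ ℓ)
  IsNilpotent = ∃[ n ] Universal (UpperCentral n)

  module _ {d} (D : Pred Carrier d) where

    Quotients : Carrier → Pred (Carrier × Carrier) (d ⊔ ℓ)
    Quotients g (d₁ , d₂) = D d₁ × D d₂ × ¬ (d₁ ≈ d₂) × g ≈ d₁ ∙ d₂ ⁻¹

    record IsDifferenceSet (v k λ′ : ℕ) : Set (c ⊔ ℓ ⊔ d) where
      field
        respects : D Respects _≈_
        order    : HasOrder v
        size     : HasSize (subsetSetoid setoid D) k
        quotients : ∀ g → ¬ (g ≈ ε) →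
                    HasSize (subsetSetoid (setoid ×ₛ setoid) (Quotients g)) λ′

    Inverses : Pred Carrier (c ⊔ ℓ ⊔ d)
    Inverses g = ∃[ x ] D x × g ≈ x ⁻¹

    record IsSkewHadamard : Set (c ⊔ ℓ ⊔ d) where
      field
        differenceSet : ∃[ v ] ∃[ k ] ∃[ λ′ ] IsDifferenceSet v k λ′
        cover         : Universal (D ∪ Inverses ∪ (_≈ ε))
        D⊥D⁻¹         : D ⊥ Inverses
        D⊥1           : D ⊥ (_≈ ε)
        D⁻¹⊥1         : Inverses ⊥ (_≈ ε)

  AdmitsSHDS : ∀ d → Set (c ⊔ ℓ ⊔ lsuc d)
  AdmitsSHDS d = Σ[ D ∈ Pred Carrier d ] IsSkewHadamard D

{-# OPTIONS --safe #-}

-- Let f = 1_D − 1_{D⁻¹}. The difference set axioms give f * f = 1_G − v 1_ε in the group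
-- ring ℤ[G], and v ≡ 3 (mod 4). If A is an abelian quotient of G of order n without elements
-- of prime order r, then the image b of f in ℤ[A] satisfies b * b = m 1_A − v 1_ε with v = n
-- m. When r ∣ m this forces b * b ≡ 0 (mod r), and since the Frobenius map b ↦ bʳ is
-- injective on 𝔽ᵣ[A], b is divisible by r, hence m by r²; replacing b by b / r, one sees
-- that the exponent of r in m, and so in v, is even. If two primes divide v, a nilpotent G
-- has a nontrivial such quotient A for every prime r: divide out repeatedly the r-torsion of
-- the centre, which kills only elements of r-power order; in the resulting group all factors
-- of the upper central series are free of r-torsion (Mal'cev), so the topmost factor will
-- do. Then v would be a square. Both Cauchy's theorem and the Frobenius argument count
-- tuples in Gʳ modulo cyclic rotation.
module Submission where

open import Defs
open import Algebra.Bundles using (Group)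
open import Data.Nat.Primality using (Prime)
open import Data.Product.Base using (_×_; ∃-syntax)

-- The obstacle is constructive. The kernel of the map to A is built from unions and universally
-- quantified conditions that come without a decision procedure, while A must be enumerated before
-- sums over it make sense. So A is obtained only up to double negation. Nothing is lost, since its
-- sole use is to refute the existence of a second prime divisor of v, whereas p itself is found by
-- arithmetic on v. A must be nontrivial because m is a coefficient of b * b only away from the
-- identity; this is how r ∣ b yields r² ∣ m. The exponent of r in v = n m is that in m because r
-- does not divide n, by Cauchy's theorem in A. The formula for f * f and the congruence v ≡ 3 (mod
-- 4) have one origin: f * f is constant off the identity, and comparing the sum of its coefficients
-- with (Σ f)² = 0 forces this constant, v - 2 - 4 λ, to be 1.

module QuotientGroups where
  open import Level using (0ℓ)
  import Algebra.Properties.Group as GroupProperties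
  open import Data.Fin.Base using (zero; suc)
  open import Data.Nat.Base using (ℕ; zero; suc; _≤_; _⊔_)
  import Data.Nat.Base as ℕ
  import Data.Nat.Properties as ℕ
  open import Data.Nat.Coprimality using (Coprime)
  import Data.Nat.Coprimality as Coprime
  open import Data.Nat.GCD using (module Bézout)
  open import Data.Product.Base using (Σ; _×_; ∃-syntax; _,_; proj₁; proj₂)
  open import Function.Base using (_∘_)
  open import Relation.Binary.Definitions using (_Respects_)
  import Relation.Binary.PropositionalEquality as ≡
  open ≡ using (_≡_)
  import Relation.Binary.Reasoning.Setoid as SetoidReasoning
  open import Relation.Nullary.Negation.Core using (¬_; contradiction)
  open import Relation.Unary using (Pred)

  -- Normal subgroups and quotient groups.

  module _ (G : Group 0ℓ 0ℓ) where
    open Group G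

    record NormalSubgroup : Set₁ where
      field
        Mem      : Pred Carrier 0ℓ
        respects : Mem Respects _≈_
        ε-mem    : Mem ε
        ∙-mem    : ∀ {x y} → Mem x → Mem y → Mem (x ∙ y)
        ⁻¹-mem   : ∀ {x} → Mem x → Mem (x ⁻¹)
        conj-mem : ∀ g {x} → Mem x → Mem (g ∙ x ∙ g ⁻¹)

  -- The quotient keeps the carrier and the operations and coarsens the equality.
  module _ (G : Group 0ℓ 0ℓ) (N : NormalSubgroup G) where
    open Group G
    open GroupProperties G
    open NormalSubgroup N
    open SetoidReasoning setoid

    infixl 7 _/_
    _/_ : Group 0ℓ 0ℓ
    _/_ = record
      { Carrier = Carrier
      ; _≈_ = λ x y → Mem (x ∙ y ⁻¹)
      ; _∙_ = _∙_
      ; ε = ε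
      ; _⁻¹ = _⁻¹
      ; isGroup = record
        { isMonoid = record
          { isSemigroup = record
            { isMagma = record
              { isEquivalence = record
                { refl = fromEq refl
                ; sym = λ {x} {y} → respects (sym-eq x y) ∘ ⁻¹-mem
                ; trans = λ {x} {y} {z} p q → respects (trans-eq x y z) (∙-mem p q)
                }
              ; ∙-cong = λ {x} {y} {u} {v} p q →
                  respects (cong-eq x y u v) (∙-mem (conj-mem x q) p)
              }
            ; assoc = λ x y z → fromEq (assoc x y z)
            }
          ; identity = (fromEq ∘ identityˡ) , (fromEq ∘ identityʳ)
          }
        ; inverse = (fromEq ∘ inverseˡ) , (fromEq ∘ inverseʳ)
        ; ⁻¹-cong = λ {x} {y} p →
            respects (inv-eq x y) (conj-mem (x ⁻¹) (⁻¹-mem p))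
        }
      }
      where
      fromEq : ∀ {x y} → x ≈ y → Mem (x ∙ y ⁻¹)
      fromEq x≈y = respects (sym (x≈y⇒x∙y⁻¹≈ε x≈y)) ε-mem

      sym-eq : ∀ x y → (x ∙ y ⁻¹) ⁻¹ ≈ y ∙ x ⁻¹
      sym-eq x y = trans (⁻¹-anti-homo-∙ x (y ⁻¹)) (∙-congʳ (⁻¹-involutive y))

      trans-eq : ∀ x y z → (x ∙ y ⁻¹) ∙ (y ∙ z ⁻¹) ≈ x ∙ z ⁻¹
      trans-eq x y z = trans (assoc x (y ⁻¹) (y ∙ z ⁻¹)) (∙-congˡ (\\-leftDividesʳ y (z ⁻¹)))

      cong-eq : ∀ x y u v → x ∙ (u ∙ v ⁻¹) ∙ x ⁻¹ ∙ (x ∙ y ⁻¹) ≈ x ∙ u ∙ (y ∙ v) ⁻¹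
      cong-eq x y u v = begin
        x ∙ (u ∙ v ⁻¹) ∙ x ⁻¹ ∙ (x ∙ y ⁻¹)   ≈⟨ assoc _ _ _ ⟩
        x ∙ (u ∙ v ⁻¹) ∙ (x ⁻¹ ∙ (x ∙ y ⁻¹)) ≈⟨ ∙-cong (sym (assoc x u (v ⁻¹))) (\\-leftDividesʳ x (y ⁻¹)) ⟩
        x ∙ u ∙ v ⁻¹ ∙ y ⁻¹                  ≈⟨ assoc _ _ _ ⟩
        x ∙ u ∙ (v ⁻¹ ∙ y ⁻¹)                ≈⟨ ∙-congˡ (⁻¹-anti-homo-∙ y v) ⟨
        x ∙ u ∙ (y ∙ v) ⁻¹                   ∎

      inv-eq : ∀ x y → x ⁻¹ ∙ (x ∙ y ⁻¹) ⁻¹ ∙ x ⁻¹ ⁻¹ ≈ x ⁻¹ ∙ y ⁻¹ ⁻¹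
      inv-eq x y = begin
        x ⁻¹ ∙ (x ∙ y ⁻¹) ⁻¹ ∙ x ⁻¹ ⁻¹       ≈⟨ assoc _ _ _ ⟩
        x ⁻¹ ∙ ((x ∙ y ⁻¹) ⁻¹ ∙ x ⁻¹ ⁻¹)     ≈⟨ ∙-congˡ (∙-cong (⁻¹-anti-homo-∙ x (y ⁻¹)) (⁻¹-involutive x)) ⟩
        x ⁻¹ ∙ (y ⁻¹ ⁻¹ ∙ x ⁻¹ ∙ x)          ≈⟨ ∙-congˡ (//-rightDividesˡ x (y ⁻¹ ⁻¹)) ⟩
        x ⁻¹ ∙ y ⁻¹ ⁻¹                       ∎

  module _ {G : Group 0ℓ 0ℓ} (N : NormalSubgroup G) where
    open Group G
    open GroupProperties G
    open NormalSubgroup N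

    mem⇒≈ε : ∀ {x} → Mem x → Group._≈_ (G / N) x ε
    mem⇒≈ε = respects (sym (trans (∙-congˡ ε⁻¹≈ε) (identityʳ _)))

    ≈ε⇒mem : ∀ {x} → Group._≈_ (G / N) x ε → Mem x
    ≈ε⇒mem = respects (trans (∙-congˡ ε⁻¹≈ε) (identityʳ _))

    ≈⇒/≈ : ∀ {x y} → x ≈ y → Group._≈_ (G / N) x y
    ≈⇒/≈ x≈y = respects (sym (x≈y⇒x∙y⁻¹≈ε x≈y)) ε-mem

    -- The projection to `G / N` is the identity on carriers, so the predicate stays the same and
    -- only the equality it has to respect becomes finer.
    preimage : NormalSubgroup (G / N) → NormalSubgroup G
    preimage M = record
      { Mem = M.Mem
      ; respects = λ x≈y → M.respects (≈⇒/≈ x≈y)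
      ; ε-mem = M.ε-mem
      ; ∙-mem = M.∙-mem
      ; ⁻¹-mem = M.⁻¹-mem
      ; conj-mem = M.conj-mem
      }
      where module M = NormalSubgroup M

  -- The multiples of Algebra.Definitions.RawMonoid depend on the equality of the monoid,
  -- so those of a group and of its quotients are not definitionally equal.
  power : (G : Group 0ℓ 0ℓ) → ℕ → Group.Carrier G → Group.Carrier G
  power G = iterate (Group._∙_ G) (Group.ε G)
    where
    iterate : ∀ {A : Set} → (A → A → A) → A → ℕ → A → A
    iterate _∙_ ε zero    x = ε
    iterate _∙_ ε (suc n) x = x ∙ iterate _∙_ ε n x

  -- Powers, commutators and central elements.

  module _ (G : Group 0ℓ 0ℓ) where
    open Group G
    open GroupProperties G
    open SetoidReasoning setoid

    private
      infixr 8 _×ᵍ_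
      _×ᵍ_ : ℕ → Carrier → Carrier
      n ×ᵍ x = power G n x

    power-cong : ∀ n {x y} → x ≈ y → n ×ᵍ x ≈ n ×ᵍ y
    power-cong zero    x≈y = refl
    power-cong (suc n) x≈y = ∙-cong x≈y (power-cong n x≈y)

    power-+ : ∀ m n x → (m ℕ.+ n) ×ᵍ x ≈ m ×ᵍ x ∙ n ×ᵍ x
    power-+ zero    n x = sym (identityˡ _)
    power-+ (suc m) n x = trans (∙-congˡ (power-+ m n x)) (sym (assoc x _ _))

    power-* : ∀ m n x → m ×ᵍ n ×ᵍ x ≈ (m ℕ.* n) ×ᵍ x
    power-* zero    n x = refl
    power-* (suc m) n x = trans (∙-congˡ (power-* m n x)) (sym (power-+ n (m ℕ.* n) x))

    Central : Pred Carrier 0ℓ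
    Central x = ∀ y → x ∙ y ≈ y ∙ x

    commutator-≈ : ∀ {x y c} → x ∙ y ≈ y ∙ x ∙ c → commutator G x y ≈ c
    commutator-≈ {x} {y} {c} eq = begin
      x ⁻¹ ∙ y ⁻¹ ∙ (x ∙ y)     ≈⟨ ∙-cong (sym (⁻¹-anti-homo-∙ y x)) eq ⟩
      (y ∙ x) ⁻¹ ∙ (y ∙ x ∙ c)  ≈⟨ \\-leftDividesʳ (y ∙ x) c ⟩
      c                         ∎

    swap-commutator : ∀ x y → x ∙ y ≈ y ∙ x ∙ commutator G x y
    swap-commutator x y = begin
      x ∙ y                                 ≈⟨ \\-leftDividesˡ (y ∙ x) (x ∙ y) ⟨
      y ∙ x ∙ ((y ∙ x) ⁻¹ ∙ (x ∙ y))        ≈⟨ ∙-congˡ (∙-congʳ (⁻¹-anti-homo-∙ y x)) ⟩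
      y ∙ x ∙ (x ⁻¹ ∙ y ⁻¹ ∙ (x ∙ y))       ∎

    commute⇒commutator≈ε : ∀ {x y} → x ∙ y ≈ y ∙ x → commutator G x y ≈ ε
    commute⇒commutator≈ε eq = commutator-≈ (trans eq (sym (identityʳ _)))

    commutator≈ε⇒commute : ∀ {x y} → commutator G x y ≈ ε → x ∙ y ≈ y ∙ x
    commutator≈ε⇒commute {x} {y} eq = begin
      x ∙ y                      ≈⟨ swap-commutator x y ⟩
      y ∙ x ∙ commutator G x y   ≈⟨ ∙-congˡ eq ⟩
      y ∙ x ∙ ε                  ≈⟨ identityʳ _ ⟩
      y ∙ x                      ∎

    central-respects : Central Respects _≈_
    central-respects x≈x′ cx y = trans (∙-congʳ (sym x≈x′)) (trans (cx y) (∙-congˡ x≈x′))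

    ε-central : Central ε
    ε-central y = trans (identityˡ y) (sym (identityʳ y))

    ∙-central : ∀ {x y} → Central x → Central y → Central (x ∙ y)
    ∙-central {x} {y} cx cy z = begin
      x ∙ y ∙ z    ≈⟨ assoc x y z ⟩
      x ∙ (y ∙ z)  ≈⟨ ∙-congˡ (cy z) ⟩
      x ∙ (z ∙ y)  ≈⟨ assoc x z y ⟨
      x ∙ z ∙ y    ≈⟨ ∙-congʳ (cx z) ⟩
      z ∙ x ∙ y    ≈⟨ assoc z x y ⟩
      z ∙ (x ∙ y)  ∎

    ⁻¹-central : ∀ {x} → Central x → Central (x ⁻¹)
    ⁻¹-central {x} cx y = begin
      x ⁻¹ ∙ y                 ≈⟨ ∙-congˡ (//-rightDividesʳ x y) ⟨
      x ⁻¹ ∙ (y ∙ x ∙ x ⁻¹)    ≈⟨ ∙-congˡ (∙-congʳ (cx y)) ⟨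
      x ⁻¹ ∙ (x ∙ y ∙ x ⁻¹)    ≈⟨ ∙-congˡ (assoc x y (x ⁻¹)) ⟩
      x ⁻¹ ∙ (x ∙ (y ∙ x ⁻¹))  ≈⟨ \\-leftDividesʳ x (y ∙ x ⁻¹) ⟩
      y ∙ x ⁻¹                 ∎

    central-conj : ∀ g {x} → Central x → x ≈ g ∙ x ∙ g ⁻¹
    central-conj g {x} cx = trans (sym (//-rightDividesʳ g x)) (∙-congʳ (cx g))

    power-ε : ∀ n → n ×ᵍ ε ≈ ε
    power-ε zero    = refl
    power-ε (suc n) = trans (identityˡ _) (power-ε n)

    power-central : ∀ n {x} → Central x → Central (n ×ᵍ x)
    power-central zero    cx = ε-central
    power-central (suc n) cx = ∙-central cx (power-central n cx)

    power-∙ : ∀ n {x} y → Central x → n ×ᵍ (x ∙ y) ≈ n ×ᵍ x ∙ n ×ᵍ y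
    power-∙ zero    y cx = sym (identityˡ ε)
    power-∙ (suc n) {x} y cx = begin
      x ∙ y ∙ n ×ᵍ (x ∙ y)          ≈⟨ ∙-congˡ (power-∙ n y cx) ⟩
      x ∙ y ∙ (n ×ᵍ x ∙ n ×ᵍ y)     ≈⟨ assoc x y _ ⟩
      x ∙ (y ∙ (n ×ᵍ x ∙ n ×ᵍ y))   ≈⟨ ∙-congˡ (assoc y _ _) ⟨
      x ∙ (y ∙ n ×ᵍ x ∙ n ×ᵍ y)     ≈⟨ ∙-congˡ (∙-congʳ (power-central n cx y)) ⟨
      x ∙ (n ×ᵍ x ∙ y ∙ n ×ᵍ y)     ≈⟨ ∙-congˡ (assoc _ y _) ⟩
      x ∙ (n ×ᵍ x ∙ (y ∙ n ×ᵍ y))   ≈⟨ assoc x _ _ ⟨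
      x ∙ n ×ᵍ x ∙ (y ∙ n ×ᵍ y)     ∎

    -- Moving y to the left past one factor x leaves a factor c = [x , y] behind; c is central, so
    -- the n of them collect at the right end.
    commutator-power : ∀ n {x y} → Central (commutator G x y) →
                   commutator G (n ×ᵍ x) y ≈ n ×ᵍ commutator G x y
    commutator-power n {x} {y} cc = commutator-≈ (swap n)
      where
      c = commutator G x y
      swap : ∀ n → n ×ᵍ x ∙ y ≈ y ∙ n ×ᵍ x ∙ n ×ᵍ c
      swap zero = trans (ε-central y) (sym (identityʳ _))
      swap (suc n) = begin
        x ∙ n ×ᵍ x ∙ y                   ≈⟨ assoc _ _ _ ⟩
        x ∙ (n ×ᵍ x ∙ y)                 ≈⟨ ∙-congˡ (swap n) ⟩
        x ∙ (y ∙ n ×ᵍ x ∙ n ×ᵍ c)        ≈⟨ ∙-congˡ (assoc _ _ _) ⟩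
        x ∙ (y ∙ (n ×ᵍ x ∙ n ×ᵍ c))      ≈⟨ assoc _ _ _ ⟨
        x ∙ y ∙ (n ×ᵍ x ∙ n ×ᵍ c)        ≈⟨ ∙-congʳ (swap-commutator x y) ⟩
        y ∙ x ∙ c ∙ (n ×ᵍ x ∙ n ×ᵍ c)    ≈⟨ assoc _ _ _ ⟩
        y ∙ x ∙ (c ∙ (n ×ᵍ x ∙ n ×ᵍ c))  ≈⟨ ∙-congˡ (assoc _ _ _) ⟨
        y ∙ x ∙ (c ∙ n ×ᵍ x ∙ n ×ᵍ c)    ≈⟨ ∙-congˡ (∙-congʳ (cc (n ×ᵍ x))) ⟩
        y ∙ x ∙ (n ×ᵍ x ∙ c ∙ n ×ᵍ c)    ≈⟨ ∙-congˡ (assoc _ _ _) ⟩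
        y ∙ x ∙ (n ×ᵍ x ∙ (c ∙ n ×ᵍ c))  ≈⟨ assoc _ _ _ ⟨
        y ∙ x ∙ n ×ᵍ x ∙ (c ∙ n ×ᵍ c)    ≈⟨ ∙-congʳ (assoc _ _ _) ⟩
        y ∙ (x ∙ n ×ᵍ x) ∙ (c ∙ n ×ᵍ c)  ∎

    power-bézout : ∀ a b {m n x} → m ×ᵍ x ≈ ε → n ×ᵍ x ≈ ε → suc (b ℕ.* n) ≡ a ℕ.* m → x ≈ ε
    power-bézout a b {m} {n} {x} mx nx eq = begin
      x                     ≈⟨ identityʳ x ⟨
      x ∙ ε                 ≈⟨ ∙-congˡ (trans (power-cong b nx) (power-ε b)) ⟨
      x ∙ b ×ᵍ (n ×ᵍ x)     ≈⟨ ∙-congˡ (power-* b n x) ⟩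
      suc (b ℕ.* n) ×ᵍ x    ≡⟨ ≡.cong (_×ᵍ x) eq ⟩
      (a ℕ.* m) ×ᵍ x        ≈⟨ power-* a m x ⟨
      a ×ᵍ (m ×ᵍ x)         ≈⟨ power-cong a mx ⟩
      a ×ᵍ ε                ≈⟨ power-ε a ⟩
      ε                     ∎

    power-coprime : ∀ {m n} → Coprime m n → ∀ {x} → m ×ᵍ x ≈ ε → n ×ᵍ x ≈ ε → x ≈ ε
    power-coprime {m} {n} cop {x} mx nx with Coprime.coprime-Bézout cop
    ... | Bézout.+- a b eq = power-bézout a b mx nx eq
    ... | Bézout.-+ a b eq = power-bézout b a nx mx eq

    centre : NormalSubgroup G
    centre = record
      { Mem = Central
      ; respects = central-respects
      ; ε-mem = ε-central
      ; ∙-mem = ∙-central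
      ; ⁻¹-mem = ⁻¹-central
      ; conj-mem = λ g cx → central-respects (central-conj g cx) cx
      }

    -- Elements with xʳ = 1 need not be closed under products in general; central ones are, by
    -- `power-∙`.
    centralTorsion : ℕ → NormalSubgroup G
    centralTorsion r = record
      { Mem = λ x → Central x × r ×ᵍ x ≈ ε
      ; respects = λ x≈y (cx , rx) → central-respects x≈y cx , trans (power-cong r (sym x≈y)) rx
      ; ε-mem = ε-central , power-ε r
      ; ∙-mem = λ {x} {y} (cx , rx) (cy , ry) → ∙-central cx cy ,
          trans (power-∙ r y cx) (trans (∙-cong rx ry) (identityˡ ε))
      ; ⁻¹-mem = λ {x} (cx , rx) → ⁻¹-central cx , (begin
          r ×ᵍ (x ⁻¹)               ≈⟨ identityˡ _ ⟨
          ε ∙ r ×ᵍ (x ⁻¹)           ≈⟨ ∙-congʳ rx ⟨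
          r ×ᵍ x ∙ r ×ᵍ (x ⁻¹)      ≈⟨ power-∙ r (x ⁻¹) cx ⟨
          r ×ᵍ (x ∙ x ⁻¹)         ≈⟨ power-cong r (inverseʳ x) ⟩
          r ×ᵍ ε                  ≈⟨ power-ε r ⟩
          ε                       ∎)
      ; conj-mem = λ g (cx , rx) → central-respects (central-conj g cx) cx ,
          trans (power-cong r (sym (central-conj g cx))) rx
      }

  -- The upper central series and its torsion.

  module _ (G : Group 0ℓ 0ℓ) where
    open Group G
    open GroupProperties G

    -- Taking preimages of centres gives normality at once, and membership at `suc i` unfolds to
    -- commuting with everything modulo level i. The two lemmas declared next translate to and from
    -- the commutator form of `UpperCentral`.
    upperCentral : ∀ i → NormalSubgroup G
    upperCentral-mem : ∀ i {x} → NormalSubgroup.Mem (upperCentral i) x → UpperCentral G i x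
    upperCentral-mem⁻¹ : ∀ i {x} → UpperCentral G i x → NormalSubgroup.Mem (upperCentral i) x

    upperCentral zero = record
      { Mem = _≈ ε
      ; respects = λ x≈y x≈ε → trans (sym x≈y) x≈ε
      ; ε-mem = refl
      ; ∙-mem = λ p q → trans (∙-cong p q) (identityˡ ε)
      ; ⁻¹-mem = λ p → trans (⁻¹-cong p) ε⁻¹≈ε
      ; conj-mem = λ g p → trans (∙-congʳ (trans (∙-congˡ p) (identityʳ g))) (inverseʳ g)
      }
    upperCentral (suc i) = preimage (upperCentral i) (centre (G / upperCentral i))

    upperCentral-mem zero    p = base p
    upperCentral-mem (suc i) p = step λ y → upperCentral-mem i
      (≈ε⇒mem (upperCentral i) (commute⇒commutator≈ε (G / upperCentral i) (p y)))

    upperCentral-mem⁻¹ zero    (base p) = p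
    upperCentral-mem⁻¹ (suc i) (step h) y = commutator≈ε⇒commute (G / upperCentral i)
      (mem⇒≈ε (upperCentral i) (upperCentral-mem⁻¹ i (h y)))

  -- Commutators in `G / N` are the same terms as in G, so only the equation at the bottom of the
  -- series has to be weakened.
  UpperCentral-/ : ∀ {G : Group 0ℓ 0ℓ} (N : NormalSubgroup G) i {x} →
                   UpperCentral G i x → UpperCentral (G / N) i x
  UpperCentral-/ N zero    (base p) = base (≈⇒/≈ N p)
  UpperCentral-/ N (suc i) (step h) = step λ y → UpperCentral-/ N i (h y)

  -- Mal'cev: the map [-, y] : Zᵢ₊₂ / Zᵢ₊₁ → Zᵢ₊₁ / Zᵢ is a homomorphism for every y,
  -- so absence of r-torsion propagates up the series.
  upperCentral-torsionFree : ∀ G r →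
    (∀ {x} → Central G x → Group._≈_ G (power G r x) (Group.ε G) → Group._≈_ G x (Group.ε G)) →
    ∀ i {x} → NormalSubgroup.Mem (upperCentral G (suc i)) x →
    NormalSubgroup.Mem (upperCentral G i) (power G r x) → NormalSubgroup.Mem (upperCentral G i) x
  upperCentral-torsionFree G r tf zero {x} cx rx =
    tf (λ y → x∙y⁻¹≈ε⇒x≈y _ _ (cx y)) rx
    where open GroupProperties G
  upperCentral-torsionFree G r tf (suc i) {x} cx rx y = commutator≈ε⇒commute G/Zᵢ (mem⇒≈ε Zᵢ
      (upperCentral-torsionFree G r tf i [x,y]-mem
        (≈ε⇒mem Zᵢ (Group.trans G/Zᵢ (Group.sym G/Zᵢ (commutator-power G/Zᵢ r [x,y]-mem))
          (commute⇒commutator≈ε G/Zᵢ (rx y))))))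
    where
    Zᵢ = upperCentral G i
    G/Zᵢ = G / Zᵢ
    -- As x ∈ Zᵢ₊₂, the commutator lies in Zᵢ₊₁ and is central modulo Zᵢ; this allows
    -- `commutator-power` to identify [xʳ , y] with [x , y]ʳ there.
    [x,y]-mem : Central G/Zᵢ (commutator G x y)
    [x,y]-mem = ≈ε⇒mem (upperCentral G (suc i)) (commute⇒commutator≈ε (G / upperCentral G (suc i)) (cx y))

  -- Dividing out the central r-torsion repeatedly.

  module _ (G : Group 0ℓ 0ℓ) (r : ℕ) where
    open Group G
    open GroupProperties G
    open NormalSubgroup

    torsionSeries : ℕ → NormalSubgroup G
    torsionSeries zero    = upperCentral G zero
    torsionSeries (suc j) = preimage (torsionSeries j) (centralTorsion (G / torsionSeries j) r)

    torsionSeries-suc : ∀ j {x} → Mem (torsionSeries j) x → Mem (torsionSeries (suc j)) x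
    torsionSeries-suc j p = respects (centralTorsion (G / torsionSeries j) r)
      (Group.sym (G / torsionSeries j) (mem⇒≈ε (torsionSeries j) p)) (ε-mem (centralTorsion (G / torsionSeries j) r))

    torsionSeries-≤ : ∀ {i j} → i ≤ j → ∀ {x} → Mem (torsionSeries i) x → Mem (torsionSeries j) x
    torsionSeries-≤ i≤j = go (ℕ.≤⇒≤′ i≤j)
      where
      go : ∀ {i j} → i ℕ.≤′ j → ∀ {x} → Mem (torsionSeries i) x → Mem (torsionSeries j) x
      go (ℕ.≤′-reflexive ≡.refl) p = p
      go (ℕ.≤′-step {n = j} i≤j) {x} p = torsionSeries-suc j {x} (go i≤j p)

    -- An element of a layer is killed by r modulo the layer below, and it is killed by q; Bézout
    -- pushes it down layer by layer. Hence elements of order q survive the quotient.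
    torsionSeries-coprime : ∀ {q} → Coprime q r → ∀ j {x} → Mem (torsionSeries j) x → power G q x ≈ ε → x ≈ ε
    torsionSeries-coprime cop zero    p qx = p
    torsionSeries-coprime cop (suc j) p qx = torsionSeries-coprime cop j
      (≈ε⇒mem Nⱼ (power-coprime (G / Nⱼ) cop (≈⇒/≈ Nⱼ qx) (proj₂ p))) qx
      where Nⱼ = torsionSeries j

    -- In a finite group the series becomes stationary; taking its union avoids having to find the
    -- index from which on it is.
    torsionRadical : NormalSubgroup G
    torsionRadical = record
      { Mem = λ x → ∃[ j ] Mem (torsionSeries j) x
      ; respects = λ x≈y (j , p) → j , respects (torsionSeries j) x≈y p
      ; ε-mem = 0 , refl
      ; ∙-mem = λ (i , p) (j , q) → i ⊔ j , ∙-mem (torsionSeries (i ⊔ j))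
          (torsionSeries-≤ (ℕ.m≤m⊔n i j) p) (torsionSeries-≤ (ℕ.m≤n⊔m i j) q)
      ; ⁻¹-mem = λ (j , p) → j , ⁻¹-mem (torsionSeries j) p
      ; conj-mem = λ g (j , p) → j , conj-mem (torsionSeries j) g p
      }

    -- Finiteness of G enters here only through this principle: for a monotone family, bounds that
    -- depend on x can be replaced by a common one.
    module _ (uniform : ∀ {P : ℕ → Pred Carrier 0ℓ} → (∀ {i j x} → i ≤ j → P i x → P j x) →
                        (∀ x → ∃[ j ] P j x) → ∃[ j ] (∀ x → P j x)) where

      -- Each relation x y = y x modulo the radical holds at a layer depending on y; by `uniform`
      -- one layer serves all y, and x enters the next one. So the quotient has no central r-torsion
      -- left.
      torsionRadical-centre : ∀ {x} → Central (G / torsionRadical) x →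
                              Group._≈_ (G / torsionRadical) (power G r x) ε → Mem torsionRadical x
      torsionRadical-centre {x} cx rx
        with uniform {λ j y → Mem (torsionSeries j) (x ∙ y ∙ (y ∙ x) ⁻¹)} (λ i≤j → torsionSeries-≤ i≤j) cx
           | ≈ε⇒mem torsionRadical rx
      ... | i , p | j , q = suc (i ⊔ j) ,
        (λ y → torsionSeries-≤ (ℕ.m≤m⊔n i j) (p y)) ,
        mem⇒≈ε (torsionSeries (i ⊔ j)) (torsionSeries-≤ (ℕ.m≤n⊔m i j) q)

  -- A search downwards from n would have to decide P at each index. Without decidability the jump
  -- exists only up to double negation.
  lastFailure : ∀ {P : ℕ → Set} n → P n → ¬ P 0 → ¬ ¬ (∃[ i ] P (suc i) × ¬ P i)
  lastFailure zero    p₀ ¬p₀ = contradiction p₀ ¬p₀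
  lastFailure (suc n) p ¬p₀ none = none (n , p , λ pₙ → lastFailure n pₙ ¬p₀ none)

  module _ (G : Group 0ℓ 0ℓ) (nilpotent : IsNilpotent G)
    (uniform : ∀ {P : ℕ → Pred (Group.Carrier G) 0ℓ} → (∀ {i j x} → i ≤ j → P i x → P j x) →
               (∀ x → ∃[ j ] P j x) → ∃[ j ] (∀ x → P j x)) where
    open Group G
    open NormalSubgroup

    abelianQuotient : ∀ {q r u} → Coprime q r → ¬ u ≈ ε → power G q u ≈ ε →
      ¬ ¬ (Σ (NormalSubgroup G) λ N → (∀ x y → Mem N (x ∙ y ∙ (y ∙ x) ⁻¹)) ×
           (∀ {x} → Mem N (power G r x) → Mem N x) × ¬ (∀ x → Mem N x))
    abelianQuotient {q} {r} {u} cop u≉ε qu none =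
      lastFailure n
        (λ x → upperCentral-mem⁻¹ Q n (UpperCentral-/ R n (proj₂ nilpotent x)))
        -- If Q were trivial, u would lie in some layer of the r-torsion series, although it is
        -- killed by q and differs from ε.
        (λ all → let j , u∈Nⱼ = ≈ε⇒mem R (all u) in u≉ε (torsionSeries-coprime G r cop j u∈Nⱼ qu))
        λ (i , top , proper) → none
          -- Here Zᵢ₊₁ is all of Q and Zᵢ is not. By the definition of the series, `top` literally
          -- says that Q / Zᵢ is commutative.
          ( preimage R (upperCentral Q i) , top
          , upperCentral-torsionFree Q r
              (λ cx rx → mem⇒≈ε R (torsionRadical-centre G r uniform cx rx)) i (top _)
          , proper )
      where
      n = proj₁ nilpotent
      R = torsionRadical G r
      Q = G / R

open QuotientGroups

-- Sums over tuples, modulo cyclic rotation.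

module TupleSums where
  open import Data.Bool.Base using (if_then_else_)
  open import Data.Fin.Base using (Fin; zero; suc; inject₁)
  import Data.Fin.Induction as Fin
  import Data.Fin.Properties as Fin
  open import Data.Integer.Base using (ℤ; +_; _+_; _*_; _-_; -_; 0ℤ; 1ℤ)
  import Data.Integer.Base as ℤ
  import Data.Integer.Properties as ℤ
  open import Data.Integer.Divisibility.Signed using (_∣_; divides; ∣ᵤ⇒∣; ∣⇒∣ᵤ; ∣m∣n⇒∣m+n; ∣m⇒∣m*n; ∣-refl)
  open import Data.Integer.Tactic.RingSolver using (solve-∀)
  open import Data.Nat.Base using (ℕ; zero; suc; _≤_; _<_; z≤n; s≤s)
  import Data.Nat.Base as ℕ
  import Data.Nat.Properties as ℕ
  import Data.Nat.Divisibility as ℕ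
  open import Data.Nat.Primality using (Prime; euclidsLemma)
  open import Data.Nat.Coprimality using (Coprime; prime⇒coprime)
  import Data.Nat.Coprimality as Coprime
  open import Data.Nat.GCD using (module Bézout)
  open import Data.Product.Base using (∃-syntax; _,_; proj₁; proj₂)
  open import Data.Sum.Base using (_⊎_; inj₁; inj₂; [_,_]′)
  open import Data.Vec.Base using (Vec; []; _∷_; _∷ʳ_; map; lookup; replicate)
  import Data.Vec.Properties as Vec
  open import Function.Base using (_∘_)
  open import Function.Bundles using (mk⇔)
  open import Relation.Binary.PropositionalEquality
  open import Relation.Nullary.Decidable using (Dec; yes; no; does; dec-true; dec-false; does-⇔)
  open import Relation.Nullary.Negation.Core using (¬_; contradiction)

  import Algebra.Properties.Semiring.Sum ℤ.+-*-semiring as Sum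
  open import Data.Fin.Permutation using (Permutation; _⟨$⟩ʳ_)

  open ≡-Reasoning

  -- Opaque, so that unification can read off the summand from a sum.
  opaque
    sum : ∀ n → (Fin n → ℤ) → ℤ
    sum n f = Sum.sum f

  infixl 10 sum
  syntax sum n (λ i → x) = ∑[ i < n ] x

  opaque
    unfolding sum

    sum-empty : ∀ {f} → sum 0 f ≡ 0ℤ
    sum-empty = refl

    sum-suc : ∀ {n} {f : Fin (suc n) → ℤ} → sum (suc n) f ≡ f zero + ∑[ i < n ] f (suc i)
    sum-suc = refl

    sum-cong : ∀ {n} {f g : Fin n → ℤ} → (∀ i → f i ≡ g i) → sum n f ≡ sum n g
    sum-cong = Sum.sum-cong-≗

    sum-comm : ∀ {m n} {f : Fin m → Fin n → ℤ} →
               ∑[ i < m ] (∑[ j < n ] f i j) ≡ ∑[ j < n ] (∑[ i < m ] f i j)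
    sum-comm {f = f} = Sum.∑-comm f

    sum-+ : ∀ {n} {f g : Fin n → ℤ} → ∑[ i < n ] (f i + g i) ≡ sum n f + sum n g
    sum-+ {f = f} {g} = Sum.∑-distrib-+ f g

    sum-*ˡ : ∀ {n} c (f : Fin n → ℤ) → ∑[ i < n ] (c * f i) ≡ c * sum n f
    sum-*ˡ c f = sym (Sum.*-distribˡ-sum c f)

    sum-*ʳ : ∀ {n} c (f : Fin n → ℤ) → ∑[ i < n ] (f i * c) ≡ sum n f * c
    sum-*ʳ c f = sym (Sum.*-distribʳ-sum c f)

    sum-permute : ∀ {m n} {f : Fin n → ℤ} (π : Permutation m n) → sum n f ≡ ∑[ i < m ] f (π ⟨$⟩ʳ i)
    sum-permute {f = f} π = Sum.∑-permute f π

    sum-zero : ∀ {n} {f : Fin n → ℤ} → (∀ i → f i ≡ 0ℤ) → sum n f ≡ 0ℤ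
    sum-zero {n} f≡0 = trans (Sum.sum-cong-≗ f≡0) (Sum.sum-replicate-zero n)

  indicator : ∀ {a} {A : Set a} → Dec A → ℤ
  indicator d = if does d then 1ℤ else 0ℤ

  module _ {a} {A : Set a} where
    indicator-yes : (d : Dec A) → A → indicator d ≡ 1ℤ
    indicator-yes d p = cong (if_then 1ℤ else 0ℤ) (dec-true d p)

    indicator-no : (d : Dec A) → ¬ A → indicator d ≡ 0ℤ
    indicator-no d ¬p = cong (if_then 1ℤ else 0ℤ) (dec-false d ¬p)

  indicator-⇔ : ∀ {a b} {A : Set a} {B : Set b} (d : Dec A) (e : Dec B) → (A → B) → (B → A) →
                indicator d ≡ indicator e
  indicator-⇔ d e f g = cong (if_then 1ℤ else 0ℤ) (does-⇔ (mk⇔ f g) d e)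

  sum-indicator : ∀ {n} (j : Fin n) (f : Fin n → ℤ) → ∑[ i < n ] (indicator (i Fin.≟ j) * f i) ≡ f j
  sum-indicator {suc n} zero f = begin
    ∑[ i < suc n ] (indicator (i Fin.≟ zero) * f i)  ≡⟨ sum-suc ⟩
    1ℤ * f zero + _  ≡⟨ cong₂ _+_ (ℤ.*-identityˡ (f zero)) (sum-zero λ i → ℤ.*-zeroˡ (f (suc i))) ⟩
    f zero + 0ℤ      ≡⟨ ℤ.+-identityʳ _ ⟩
    f zero           ∎
  sum-indicator {suc n} (suc j) f = begin
    ∑[ i < suc n ] (indicator (i Fin.≟ suc j) * f i)           ≡⟨ sum-suc ⟩
    0ℤ * f zero + ∑[ i < n ] (indicator (i Fin.≟ j) * f (suc i))
      ≡⟨ cong₂ _+_ (ℤ.*-zeroˡ (f zero)) (sum-indicator j (f ∘ suc)) ⟩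
    0ℤ + f (suc j)                                             ≡⟨ ℤ.+-identityˡ _ ⟩
    f (suc j)                                                  ∎

  sum-const : ∀ n (z : ℤ) → ∑[ i < n ] z ≡ + n * z
  sum-const zero    z = trans sum-empty (sym (ℤ.*-zeroˡ z))
  sum-const (suc n) z = begin
    ∑[ i < suc n ] z    ≡⟨ sum-suc ⟩
    z + ∑[ i < n ] z    ≡⟨ cong (λ w → z + w) (sum-const n z) ⟩
    z + + n * z         ≡⟨ ℤ.suc-* (+ n) z ⟨
    + suc n * z         ∎

  ∣-sum : ∀ {d n} {f : Fin n → ℤ} → (∀ i → d ∣ f i) → d ∣ sum n f
  ∣-sum {d} {n = zero}  h = subst (d ∣_) (sym sum-empty) (divides 0ℤ (sym (ℤ.*-zeroˡ d)))
  ∣-sum {d} {n = suc n} h = subst (d ∣_) (sym sum-suc) (∣m∣n⇒∣m+n (h zero) (∣-sum (h ∘ suc)))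

  euclidsLemmaᶻ : ∀ {p} → Prime p → ∀ x y → + p ∣ x * y → (+ p ∣ x) ⊎ (+ p ∣ y)
  euclidsLemmaᶻ {p} pr x y h =
    [ inj₁ ∘ ∣ᵤ⇒∣ , inj₂ ∘ ∣ᵤ⇒∣ ]′ (euclidsLemma ℤ.∣ x ∣ ℤ.∣ y ∣ pr (subst (p ℕ.∣_) (ℤ.abs-* x y) (∣⇒∣ᵤ h)))

  tupleSum : ∀ n k → (Vec (Fin n) k → ℤ) → ℤ
  tupleSum n zero    F = F []
  tupleSum n (suc k) F = ∑[ x < n ] (tupleSum n k (λ xs → F (x ∷ xs)))

  module _ {n : ℕ} where
    tupleSum-cong : ∀ k {F G : Vec (Fin n) k → ℤ} → (∀ t → F t ≡ G t) → tupleSum n k F ≡ tupleSum n k G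
    tupleSum-cong zero    h = h []
    tupleSum-cong (suc k) h = sum-cong λ x → tupleSum-cong k λ xs → h (x ∷ xs)

    tupleSum-+ : ∀ k (F G : Vec (Fin n) k → ℤ) →
                 tupleSum n k (λ t → F t + G t) ≡ tupleSum n k F + tupleSum n k G
    tupleSum-+ zero    F G = refl
    tupleSum-+ (suc k) F G = trans (sum-cong λ x → tupleSum-+ k (λ xs → F (x ∷ xs)) (λ xs → G (x ∷ xs))) sum-+

    tupleSum-zero : ∀ k {F : Vec (Fin n) k → ℤ} → (∀ t → F t ≡ 0ℤ) → tupleSum n k F ≡ 0ℤ
    tupleSum-zero zero    h = h []
    tupleSum-zero (suc k) h = sum-zero λ x → tupleSum-zero k λ xs → h (x ∷ xs)

    tupleSum-∑ : ∀ k {m} (F : Fin m → Vec (Fin n) k → ℤ) →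
                 tupleSum n k (λ t → ∑[ i < m ] F i t) ≡ ∑[ i < m ] tupleSum n k (F i)
    tupleSum-∑ zero    F = refl
    tupleSum-∑ (suc k) F = trans (sum-cong λ x → tupleSum-∑ k (λ i xs → F i (x ∷ xs))) sum-comm

    tupleSum-*ˡ : ∀ k c (F : Vec (Fin n) k → ℤ) → tupleSum n k (λ t → c * F t) ≡ c * tupleSum n k F
    tupleSum-*ˡ zero    c F = refl
    tupleSum-*ˡ (suc k) c F = trans (sum-cong λ x → tupleSum-*ˡ k c (λ xs → F (x ∷ xs)))
      (sum-*ˡ c (λ x → tupleSum n k (λ xs → F (x ∷ xs))))

    ∣-tupleSum : ∀ k {d} {F : Vec (Fin n) k → ℤ} → (∀ t → d ∣ F t) → d ∣ tupleSum n k F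
    ∣-tupleSum zero    h = h []
    ∣-tupleSum (suc k) h = ∣-sum λ x → ∣-tupleSum k λ xs → h (x ∷ xs)

    -- Interchanging sums carries the variable in front to the end. Together with
    -- `RotationInvariant` this replaces an action of the cyclic group on tuples.
    tupleSum-∷ʳ : ∀ k (F : Vec (Fin n) (suc k) → ℤ) →
                  ∑[ x < n ] tupleSum n k (λ xs → F (xs ∷ʳ x)) ≡ tupleSum n (suc k) F
    tupleSum-∷ʳ zero    F = refl
    tupleSum-∷ʳ (suc k) F = trans sum-comm (sum-cong λ y → tupleSum-∷ʳ k (λ xs → F (y ∷ xs)))

  RotationInvariant : ∀ {a} {A : Set a} {n k} → (Vec (Fin n) (suc k) → A) → Set a
  RotationInvariant F = ∀ x xs → F (x ∷ xs) ≡ F (xs ∷ʳ x)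

  lookup-∷ʳ-inject₁ : ∀ {a} {A : Set a} {k} (xs : Vec A k) x i → lookup (xs ∷ʳ x) (inject₁ i) ≡ lookup xs i
  lookup-∷ʳ-inject₁ (y ∷ xs) x zero    = refl
  lookup-∷ʳ-inject₁ (y ∷ xs) x (suc i) = lookup-∷ʳ-inject₁ xs x i

  module _ {n k} (ζ : Fin n → ℤ) {F : Vec (Fin n) (suc k) → ℤ} (rot : RotationInvariant F) where

    positionSum : Fin (suc k) → ℤ
    positionSum i = tupleSum n (suc k) (λ t → ζ (lookup t i) * F t)

    -- Rotating x ∷ xs to xs ∷ʳ x moves the entry at `suc i` to `inject₁ i`.
    positionSum-step : ∀ i → positionSum (suc i) ≡ positionSum (inject₁ i)
    positionSum-step i = begin
      positionSum (suc i)
        ≡⟨ (sum-cong λ x → tupleSum-cong k λ xs →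
             cong₂ (λ l w → ζ l * w) (sym (lookup-∷ʳ-inject₁ xs x i)) (rot x xs)) ⟩
      ∑[ x < n ] tupleSum n k (λ xs → ζ (lookup (xs ∷ʳ x) (inject₁ i)) * F (xs ∷ʳ x))
        ≡⟨ tupleSum-∷ʳ k (λ t → ζ (lookup t (inject₁ i)) * F t) ⟩
      positionSum (inject₁ i) ∎

    positionSum-const : ∀ i → positionSum i ≡ positionSum zero
    positionSum-const = Fin.<-weakInduction (λ i → positionSum i ≡ positionSum zero) refl
      (λ i eq → trans (positionSum-step i) eq)

    -- All positions contribute the same amount. The resulting factor `suc k`, later the prime p,
    -- stands for the p members of an orbit under rotation.
    tupleSum-weight : tupleSum n (suc k) (λ t → (∑[ i < suc k ] ζ (lookup t i)) * F t) ≡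
                      + suc k * positionSum zero
    tupleSum-weight = begin
      tupleSum n (suc k) (λ t → (∑[ i < suc k ] ζ (lookup t i)) * F t)
        ≡⟨ (tupleSum-cong (suc k) λ t → sym (sum-*ʳ (F t) (λ i → ζ (lookup t i)))) ⟩
      tupleSum n (suc k) (λ t → ∑[ i < suc k ] (ζ (lookup t i) * F t))
        ≡⟨ tupleSum-∑ (suc k) (λ i t → ζ (lookup t i) * F t) ⟩
      ∑[ i < suc k ] positionSum i
        ≡⟨ sum-cong positionSum-const ⟩
      ∑[ i < suc k ] positionSum zero
        ≡⟨ sum-const (suc k) _ ⟩
      + suc k * positionSum zero ∎

  -- The letter `zero` is singled out because `tupleSum-mod` removes the letters of the alphabet
  -- `Fin n` one at a time.
  zeros : ∀ {n k} → Vec (Fin (suc n)) k → ℕ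
  zeros []           = 0
  zeros (zero ∷ t)   = suc (zeros t)
  zeros (suc _ ∷ t)  = zeros t

  module _ {n : ℕ} where
    zeros≤ : ∀ {k} (t : Vec (Fin (suc n)) k) → zeros t ≤ k
    zeros≤ []          = z≤n
    zeros≤ (zero ∷ t)  = s≤s (zeros≤ t)
    zeros≤ (suc _ ∷ t) = ℕ.m≤n⇒m≤1+n (zeros≤ t)

    zeros-∷ʳ : ∀ {k} x (t : Vec (Fin (suc n)) k) → zeros (x ∷ t) ≡ zeros (t ∷ʳ x)
    zeros-∷ʳ x       []           = refl
    zeros-∷ʳ zero    (zero ∷ t)   = cong suc (zeros-∷ʳ zero t)
    zeros-∷ʳ zero    (suc y ∷ t)  = zeros-∷ʳ zero t
    zeros-∷ʳ (suc x) (zero ∷ t)   = cong suc (zeros-∷ʳ (suc x) t)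
    zeros-∷ʳ (suc x) (suc y ∷ t)  = zeros-∷ʳ (suc x) t

    zeros-sum : ∀ {k} (t : Vec (Fin (suc n)) k) → ∑[ i < k ] indicator (lookup t i Fin.≟ zero) ≡ + zeros t
    zeros-sum []          = sum-empty
    zeros-sum (zero ∷ t)  = trans sum-suc (cong (λ z → 1ℤ + z) (zeros-sum t))
    zeros-sum (suc _ ∷ t) = trans sum-suc (trans (ℤ.+-identityˡ _) (zeros-sum t))

    tupleSum-noZeros : ∀ k (F : Vec (Fin (suc n)) k → ℤ) →
      tupleSum (suc n) k (λ t → indicator (zeros t ℕ.≟ 0) * F t) ≡ tupleSum n k (λ t → F (map suc t))
    tupleSum-noZeros zero    F = ℤ.*-identityˡ (F [])
    tupleSum-noZeros (suc k) F = trans sum-suc (trans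
      (cong₂ _+_ (tupleSum-zero k λ t → ℤ.*-zeroˡ (F (zero ∷ t)))
        (sum-cong λ x → tupleSum-noZeros k (λ t → F (suc x ∷ t))))
      (ℤ.+-identityˡ _))

    tupleSum-allZeros : ∀ k (F : Vec (Fin (suc n)) k → ℤ) →
      tupleSum (suc n) k (λ t → indicator (zeros t ℕ.≟ k) * F t) ≡ F (replicate k zero)
    tupleSum-allZeros zero    F = ℤ.*-identityˡ (F [])
    tupleSum-allZeros (suc k) F = trans sum-suc (trans
      (cong₂ _+_ (tupleSum-allZeros k (λ t → F (zero ∷ t))) (sum-zero λ x → tupleSum-zero k λ t →
        trans (cong (_* F (suc x ∷ t)) (indicator-no (zeros t ℕ.≟ suc k) λ eq → ℕ.<⇒≢ (s≤s (zeros≤ t)) eq))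
          (ℤ.*-zeroˡ (F (suc x ∷ t)))))
      (ℤ.+-identityʳ _))

  bézout-inverse : ∀ {m p} → Coprime m p → ∃[ a ] + p ∣ 1ℤ - + m * a
  bézout-inverse {m} {p} cop with Coprime.coprime-Bézout cop
  ... | Bézout.+- a b eq = + a , divides (- (+ b)) (begin
    1ℤ - + m * + a               ≡⟨ cong (λ z → 1ℤ - z) (ℤ.*-comm (+ m) (+ a)) ⟩
    1ℤ - + a * + m               ≡⟨ cong (λ z → 1ℤ - z) (trans (sym (ℤ.pos-* a m)) (cong +_ (sym eq))) ⟩
    1ℤ - (1ℤ + + (b ℕ.* p))       ≡⟨ cong (λ z → 1ℤ - (1ℤ + z)) (ℤ.pos-* b p) ⟩
    1ℤ - (1ℤ + + b * + p)         ≡⟨ cancel (+ b) (+ p) ⟩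
    - (+ b) * + p ∎)
    where
    cancel : ∀ b p → 1ℤ - (1ℤ + b * p) ≡ - b * p
    cancel = solve-∀
  ... | Bézout.-+ a b eq = - (+ a) , divides (+ b) (begin
    1ℤ - + m * - (+ a)           ≡⟨ negate (+ m) (+ a) ⟩
    1ℤ + + a * + m               ≡⟨ cong (λ z → 1ℤ + z) (ℤ.pos-* a m) ⟨
    + suc (a ℕ.* m)               ≡⟨ cong +_ eq ⟩
    + (b ℕ.* p)                   ≡⟨ ℤ.pos-* b p ⟩
    + b * + p                    ∎)
    where
    negate : ∀ m a → 1ℤ - m * - a ≡ 1ℤ + a * m
    negate = solve-∀

  module _ {k} (prime : Prime (suc k)) where
    private p = suc k

    -- For 0 < s < p, a is an inverse of s modulo p. At s = 0 and s = p there is none; a = 0 is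
    -- taken there, and one of the indicators cancels the 1. The bound on s comes after a, so that a
    -- is a function of s alone.
    partialInverse : ∀ s → ∃[ a ] (s ≤ p → + p ∣ 1ℤ - + s * a - indicator (s ℕ.≟ 0) - indicator (s ℕ.≟ p))
    partialInverse s = choose (s ℕ.≟ 0) (s ℕ.≟ p) (s ℕ.<? p)
      where
      Good : ℤ → Set
      Good a = + p ∣ 1ℤ - + s * a - indicator (s ℕ.≟ 0) - indicator (s ℕ.≟ p)
      vanish : 1ℤ - + s * 0ℤ ≡ 1ℤ
      vanish = cong (λ z → 1ℤ - z) (ℤ.*-zeroʳ (+ s))
      exceptional : ∀ {x y} → x + y ≡ 1ℤ → indicator (s ℕ.≟ 0) ≡ x → indicator (s ℕ.≟ p) ≡ y → Good 0ℤ
      exceptional {x} {y} x+y≡1 [s≡0] [s≡p] = divides 0ℤ (begin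
        1ℤ - + s * 0ℤ - indicator (s ℕ.≟ 0) - indicator (s ℕ.≟ p)
          ≡⟨ cong₂ _-_ (cong₂ _-_ vanish [s≡0]) [s≡p] ⟩
        1ℤ - x - y                                                  ≡⟨ regroup 1ℤ x y ⟩
        1ℤ - (x + y)                                                ≡⟨ cong (λ z → 1ℤ - z) x+y≡1 ⟩
        0ℤ                                                          ∎)
        where
        regroup : ∀ e x y → e - x - y ≡ e - (x + y)
        regroup = solve-∀
      choose : Dec (s ≡ 0) → Dec (s ≡ p) → Dec (s < p) → ∃[ a ] (s ≤ p → Good a)
      choose (yes s≡0) _ _ = 0ℤ , λ _ → exceptional refl (indicator-yes (s ℕ.≟ 0) s≡0)
        (indicator-no (s ℕ.≟ p) λ s≡p → contradiction (trans (sym s≡0) s≡p) λ ())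
      choose (no s≢0) (yes s≡p) _ = 0ℤ , λ _ →
        exceptional refl (indicator-no (s ℕ.≟ 0) s≢0) (indicator-yes (s ℕ.≟ p) s≡p)
      -- For s > p nothing is claimed, and 0 is a default value.
      choose (no s≢0) (no s≢p) (no s≮p) = 0ℤ , λ s≤p → contradiction (ℕ.≤∧≢⇒< s≤p s≢p) s≮p
      choose (no s≢0) (no s≢p) (yes s<p)
        with a , p∣ ← bézout-inverse (Coprime.sym (prime⇒coprime prime {{ℕ.≢-nonZero s≢0}} s<p)) =
        a , λ _ → subst (+ p ∣_) (sym (begin
          1ℤ - + s * a - indicator (s ℕ.≟ 0) - indicator (s ℕ.≟ p)
            ≡⟨ cong₂ (λ x y → 1ℤ - + s * a - x - y) (indicator-no (s ℕ.≟ 0) s≢0) (indicator-no (s ℕ.≟ p) s≢p) ⟩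
          1ℤ - + s * a - 0ℤ - 0ℤ  ≡⟨ trans (ℤ.+-identityʳ _) (ℤ.+-identityʳ _) ⟩
          1ℤ - + s * a            ∎)) p∣

    private
      inverseMod : ℕ → ℤ
      inverseMod s = proj₁ (partialInverse s)

    -- A tuple with s zeros, 0 < s < p, is counted by weighting it with s · s⁻¹ ≡ 1 (mod p), and
    -- a sum weighted by the number of zeros is divisible by p. Only s = 0 and s = p survive.
    tupleSum-peel : ∀ {n} {F : Vec (Fin (suc n)) p → ℤ} → RotationInvariant F →
      + p ∣ tupleSum (suc n) p F - tupleSum n p (λ t → F (map suc t)) - F (replicate p zero)
    tupleSum-peel {n} {F} rot = subst (+ p ∣_) split (∣m∣n⇒∣m+n remainder weighted)
      where
      S = tupleSum (suc n) p
      w : Vec (Fin (suc n)) p → ℤ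
      w t = inverseMod (zeros t) * F t
      w-rot : RotationInvariant w
      w-rot x xs = cong₂ (λ s z → inverseMod s * z) (zeros-∷ʳ x xs) (rot x xs)
      ζ : Fin (suc n) → ℤ
      ζ x = indicator (x Fin.≟ zero)
      weighted : + p ∣ S (λ t → (∑[ i < p ] ζ (lookup t i)) * w t)
      weighted = subst (+ p ∣_) (sym (tupleSum-weight ζ {w} w-rot)) (∣m⇒∣m*n _ ∣-refl)
      rest : Vec (Fin (suc n)) p → ℤ
      rest t = (1ℤ - + zeros t * inverseMod (zeros t) - indicator (zeros t ℕ.≟ 0) - indicator (zeros t ℕ.≟ p)) * F t
      remainder : + p ∣ S rest
      remainder = ∣-tupleSum p λ t → ∣m⇒∣m*n (F t) (proj₂ (partialInverse (zeros t)) (zeros≤ t))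
      A B C : Vec (Fin (suc n)) p → ℤ
      A t = (∑[ i < p ] ζ (lookup t i)) * w t
      B t = indicator (zeros t ℕ.≟ 0) * F t
      C t = indicator (zeros t ℕ.≟ p) * F t
      -- With c the number of zeros and i its partial inverse, 1 = (1 - c i - a - b) + c i + a + b.
      -- The first summand is divisible by p at each tuple, the second yields a multiple of p after
      -- summation; a and b are the indicators of c = 0 and c = p.
      pointwise : ∀ c i a b f → ((1ℤ - c * i - a - b) * f + c * (i * f)) + (a * f + b * f) ≡ f
      pointwise = solve-∀
      cancel : ∀ x b c → (x + (b + c)) - b - c ≡ x
      cancel = solve-∀
      split : S rest + S A ≡ S F - tupleSum n p (λ t → F (map suc t)) - F (replicate p zero)
      split = begin
        S rest + S A
          ≡⟨ cancel (S rest + S A) (S B) (S C) ⟨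
        (S rest + S A + (S B + S C)) - S B - S C
          ≡⟨ cong (λ z → z - S B - S C) (begin
               S rest + S A + (S B + S C)
                 ≡⟨ cong₂ _+_ (tupleSum-+ p rest A) (tupleSum-+ p B C) ⟨
               S (λ t → rest t + A t) + S (λ t → B t + C t)
                 ≡⟨ tupleSum-+ p (λ t → rest t + A t) (λ t → B t + C t) ⟨
               S (λ t → rest t + A t + (B t + C t))
                 ≡⟨ tupleSum-cong p (λ t → trans
                      (cong (λ z → rest t + z * w t + (B t + C t)) (zeros-sum t))
                      (pointwise (+ zeros t) (inverseMod (zeros t))
                        (indicator (zeros t ℕ.≟ 0)) (indicator (zeros t ℕ.≟ p)) (F t))) ⟩
               S F ∎) ⟩
        S F - S B - S C
          ≡⟨ cong₂ (λ b c → S F - b - c) (tupleSum-noZeros p F) (tupleSum-allZeros p F) ⟩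
        S F - tupleSum n p (λ t → F (map suc t)) - F (replicate p zero) ∎

    -- Induction on the size of the alphabet: each use of `tupleSum-peel` removes a letter and
    -- leaves its constant tuple behind. In the usual proof the constant tuples are the fixed points
    -- of rotation, all other orbits having p elements.
    tupleSum-mod : ∀ {n} {F : Vec (Fin n) p → ℤ} → RotationInvariant F →
      + p ∣ tupleSum n p F - ∑[ x < n ] (F (replicate p x))
    tupleSum-mod {zero}      rot = divides 0ℤ (cong₂ _-_ sum-empty sum-empty)
    tupleSum-mod {suc n} {F} rot = subst (+ p ∣_) combine
      (∣m∣n⇒∣m+n (tupleSum-peel {F = F} rot) (tupleSum-mod {n} {F ∘ map suc} rot′))
      where
      rot′ : RotationInvariant (F ∘ map suc)
      rot′ x xs = trans (rot (suc x) (map suc xs)) (cong F (sym (Vec.map-∷ʳ suc x xs)))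
      telescope : ∀ s t d e → (s - t - d) + (t - e) ≡ s - (d + e)
      telescope = solve-∀
      combine : _ ≡ tupleSum (suc n) p F - ∑[ x < suc n ] (F (replicate p x))
      combine = trans (telescope (tupleSum (suc n) p F) (tupleSum n p (F ∘ map suc)) (F (replicate p zero)) _)
        (cong (λ z → tupleSum (suc n) p F - z) (sym (trans sum-suc
          (cong (λ z → F (replicate p zero) + z) (sum-cong λ x → cong F (sym (Vec.map-replicate suc x p)))))))

open TupleSums

-- Group rings modulo a prime: Frobenius, Cauchy and the descent.

module FiniteGroups where
  open import Level using (0ℓ)
  open import Algebra.Core using (Op₁; Op₂)
  open import Algebra.Structures using (IsGroup)
  import Algebra.Properties.Group as GroupProperties
  open import Data.Fin.Base using (Fin; zero; suc)
  import Data.Fin.Properties as Fin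
  open import Data.Fin.Permutation using (Permutation; permutation)
  open import Data.Integer.Base using (ℤ; +_; _+_; _*_; _-_; -_; 0ℤ; 1ℤ)
  import Data.Integer.Base as ℤ
  import Data.Integer.Properties as ℤ
  open import Data.Integer.Divisibility.Signed using (_∣_; divides; ∣ᵤ⇒∣; ∣⇒∣ᵤ; ∣m∣n⇒∣m-n; ∣n⇒∣m*n; ∣m⇒∣m*n)
  open import Data.Integer.Tactic.RingSolver using (solve-∀)
  open import Data.Nat.Base using (ℕ; zero; suc; _<_)
  import Data.Nat.Base as ℕ
  import Data.Nat.Properties as ℕ
  import Data.Nat.Divisibility as ℕ
  import Data.Nat.Induction as ℕ
  import Data.Nat.Tactic.RingSolver as ℕSolver
  open import Data.Nat.Primality using (Prime; prime⇒nonZero; prime⇒nonTrivial; ¬prime[0]; ¬prime[1])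
  open import Data.Product.Base using (_×_; ∃-syntax; _,_)
  open import Data.Sum.Base using (inj₁; inj₂)
  open import Data.Vec.Base using (Vec; []; _∷_; _∷ʳ_; replicate)
  open import Induction.WellFounded using (Acc; acc)
  open import Relation.Binary.PropositionalEquality
  open import Relation.Nullary.Decidable using (yes; no; ¬?; _×-dec_)
  open import Relation.Nullary.Negation.Core using (¬_; contradiction)
  open ≡-Reasoning

  EvenValuation : ℕ → ℕ → Set
  EvenValuation p m = ∃[ s ] ∃[ u ] m ≡ (p ℕ.^ s) ℕ.* (p ℕ.^ s) ℕ.* u × ¬ p ℕ.∣ u

  record FinGroup (n : ℕ) : Set where
    field
      _∙_     : Op₂ (Fin n)
      ε       : Fin n
      _⁻¹     : Op₁ (Fin n)
      isGroup : IsGroup _≡_ _∙_ ε _⁻¹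

    group : Group 0ℓ 0ℓ
    group = record { isGroup = isGroup }

    open Group group public using (assoc; identityˡ; identityʳ; inverseˡ; inverseʳ)
    open GroupProperties group public
      using (\\-leftDividesˡ; \\-leftDividesʳ; //-rightDividesˡ; //-rightDividesʳ; ∙-cancelˡ; ∙-cancelʳ;
             ⁻¹-anti-homo-∙; ⁻¹-involutive; ε⁻¹≈ε)

    translate : Fin n → Permutation n n
    translate g = permutation (g ∙_) (g ⁻¹ ∙_) (\\-leftDividesˡ g) (\\-leftDividesʳ g)

    invert : Permutation n n
    invert = permutation _⁻¹ _⁻¹ ⁻¹-involutive ⁻¹-involutive

    infixl 7 _∙_
    infix 8 _⁻¹

    sum-translate : ∀ g {f : Fin n → ℤ} → sum n f ≡ ∑[ x < n ] (f (g ∙ x))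
    sum-translate g = sum-permute (translate g)

    sum-invert : ∀ {f : Fin n → ℤ} → sum n f ≡ ∑[ x < n ] (f (x ⁻¹))
    sum-invert = sum-permute invert

    -- The coefficient of c in b * b.
    selfConvolution : (Fin n → ℤ) → Fin n → ℤ
    selfConvolution b c = ∑[ x < n ] (b x * b (x ⁻¹ ∙ c))

    product : ∀ {k} → Vec (Fin n) k → Fin n
    product []       = ε
    product (x ∷ xs) = x ∙ product xs

    product-∷ʳ : ∀ {k} (xs : Vec (Fin n) k) x → product (xs ∷ʳ x) ≡ product xs ∙ x
    product-∷ʳ []       x = trans (identityʳ x) (sym (identityˡ x))
    product-∷ʳ (y ∷ xs) x = trans (cong (y ∙_) (product-∷ʳ xs x)) (sym (assoc y _ x))

    product-replicate : ∀ k x → product (replicate k x) ≡ power group k x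
    product-replicate zero    x = refl
    product-replicate (suc k) x = cong (x ∙_) (product-replicate k x)

  weight : ∀ {n k} → (Fin n → ℤ) → Vec (Fin n) k → ℤ
  weight b []       = 1ℤ
  weight b (x ∷ xs) = b x * weight b xs

  weight-∷ʳ : ∀ {n k} (b : Fin n → ℤ) (xs : Vec (Fin n) k) x → weight b (x ∷ xs) ≡ weight b (xs ∷ʳ x)
  weight-∷ʳ b []       x = refl
  weight-∷ʳ b (y ∷ xs) x = trans (exchange (b x) (b y) (weight b xs)) (cong (b y *_) (weight-∷ʳ b xs x))
    where
    exchange : ∀ a b c → a * (b * c) ≡ b * (a * c)
    exchange = solve-∀

  weight-replicate-∣ : ∀ {n p} (b : Fin n → ℤ) x → Prime p → ∀ k → + p ∣ weight b (replicate k x) → + p ∣ b x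
  weight-replicate-∣ b x pPrime zero p∣1 with ℕ.∣1⇒≡1 (∣⇒∣ᵤ p∣1)
  ... | refl = contradiction pPrime ¬prime[1]
  weight-replicate-∣ b x pPrime (suc k) p∣ with euclidsLemmaᶻ pPrime (b x) (weight b (replicate k x)) p∣
  ... | inj₁ p∣bx = p∣bx
  ... | inj₂ p∣w  = weight-replicate-∣ b x pPrime k p∣w

  module _ {n : ℕ} (G : FinGroup n) where
    open FinGroup G

    -- The coefficient of c in the k-th power of b, as one sum over tuples with product c, so that
    -- `tupleSum-mod` applies when k = p.
    convPower : (Fin n → ℤ) → ℕ → Fin n → ℤ
    convPower b k c = tupleSum n k (λ t → weight b t * indicator (product t Fin.≟ c))

    convPower-suc : ∀ b k c → convPower b (suc k) c ≡ ∑[ x < n ] (b x * convPower b k (x ⁻¹ ∙ c))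
    convPower-suc b k c = sum-cong λ x → trans
      (tupleSum-cong k λ xs → trans (ℤ.*-assoc (b x) (weight b xs) _)
        (cong (λ z → b x * (weight b xs * z))
          (indicator-⇔ (x ∙ product xs Fin.≟ c) (product xs Fin.≟ x ⁻¹ ∙ c)
            (λ eq → trans (sym (\\-leftDividesʳ x _)) (cong (x ⁻¹ ∙_) eq))
            (λ eq → trans (cong (x ∙_) eq) (\\-leftDividesˡ x c)))))
      (tupleSum-*ˡ k (b x) (λ xs → weight b xs * indicator (product xs Fin.≟ x ⁻¹ ∙ c)))

    convPower-one : ∀ b c → convPower b 1 c ≡ b c
    convPower-one b c = trans
      (sum-cong λ x → trans (reorder (b x) _)
        (cong (_* b x) (indicator-⇔ (x ∙ ε Fin.≟ c) (x Fin.≟ c) (trans (sym (identityʳ x))) (trans (identityʳ x)))))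
      (sum-indicator c b)
      where
      reorder : ∀ x i → x * 1ℤ * i ≡ i * x
      reorder = solve-∀

    convPower-∣ : ∀ {d} b → (∀ c → d ∣ selfConvolution b c) → ∀ k c → d ∣ convPower b (suc (suc k)) c
    convPower-∣ {d} b d∣b*b zero c = subst (d ∣_)
      (sym (trans (convPower-suc b 1 c) (sum-cong λ x → cong (b x *_) (convPower-one b _)))) (d∣b*b c)
    convPower-∣ {d} b d∣b*b (suc k) c = subst (d ∣_) (sym (convPower-suc b (suc (suc k)) c))
      (∣-sum λ x → ∣n⇒∣m*n (b x) (convPower-∣ b d∣b*b k _))

    -- The sum is, modulo p, the coefficient of c in bᵖ: among the tuples with product c only the
    -- constant ones count. As p ≥ 2, it vanishes modulo p together with b * b. The condition on c
    -- amounts to c being central, which makes the tuples with product c closed under rotation; it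
    -- is met by ε in any group and by every c in an abelian one.
    frobenius : ∀ {p} → Prime p → ∀ b → (∀ c → + p ∣ selfConvolution b c) →
      ∀ c → (∀ x y → x ∙ y ≡ c → y ∙ x ≡ c) →
      + p ∣ ∑[ x < n ] (indicator (power group p x Fin.≟ c) * weight b (replicate p x))
    frobenius {zero}          pPrime = contradiction pPrime ¬prime[0]
    frobenius {suc zero}      pPrime = contradiction pPrime ¬prime[1]
    frobenius {p@(suc (suc k))} pPrime b p∣b*b c commuting =
      subst (+ p ∣_) (diagonal (convPower b p c) _) (∣m∣n⇒∣m-n (convPower-∣ b p∣b*b k c)
        (subst (λ z → + p ∣ convPower b p c - z) (sum-cong λ x → trans
            (ℤ.*-comm (weight b (replicate p x)) _)
            (cong (λ y → indicator (y Fin.≟ c) * weight b (replicate p x)) (product-replicate p x)))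
          (tupleSum-mod pPrime {F = λ t → weight b t * indicator (product t Fin.≟ c)} rotate)))
      where
      diagonal : ∀ s d → s - (s - d) ≡ d
      diagonal = solve-∀
      rotate : RotationInvariant (λ t → weight b t * indicator (product t Fin.≟ c))
      rotate x xs = cong₂ _*_ (weight-∷ʳ b xs x)
        (indicator-⇔ (x ∙ product xs Fin.≟ c) (product (xs ∷ʳ x) Fin.≟ c)
          (λ eq → trans (product-∷ʳ xs x) (commuting _ _ eq))
          (λ eq → commuting _ _ (trans (sym (product-∷ʳ xs x)) eq)))

    -- McKay's argument: for b = 1 the coefficients of b * b are all n, so the number of solutions
    -- of xᵖ = ε is divisible by p and cannot be 1.
    cauchy : ∀ {p} → Prime p → p ℕ.∣ n → ∃[ u ] u ≢ ε × power group p u ≡ ε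
    cauchy {p} pPrime p∣n with Fin.any? (λ u → ¬? (u Fin.≟ ε) ×-dec (power group p u Fin.≟ ε))
    ... | yes found = found
    ... | no none = contradiction (weight-replicate-∣ one ε pPrime 0 p∣1) p∤1
      where
      one : Fin n → ℤ
      one _ = 1ℤ
      p∤1 : ¬ + p ∣ 1ℤ
      p∤1 p∣1 = contradiction (subst Prime (ℕ.∣1⇒≡1 (∣⇒∣ᵤ p∣1)) pPrime) ¬prime[1]
      onlyε : ∀ x → power group p x ≡ ε → x ≡ ε
      onlyε x px with x Fin.≟ ε
      ... | yes x≡ε = x≡ε
      ... | no  x≢ε = contradiction (x , x≢ε , px) none
      weight-one : ∀ k x → weight one (replicate k x) ≡ 1ℤ
      weight-one zero    x = refl
      weight-one (suc k) x = trans (ℤ.*-identityˡ _) (weight-one k x)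
      p∣1 : + p ∣ 1ℤ
      p∣1 = subst (+ p ∣_)
        (trans (sum-cong λ x → cong₂ _*_
            (indicator-⇔ (power group p x Fin.≟ ε) (x Fin.≟ ε) (onlyε x) λ { refl → power-ε group p })
            (weight-one p x))
          (sum-indicator ε one))
        (frobenius pPrime one
          (λ c → subst (+ p ∣_) (sym (trans (sum-const n 1ℤ) (ℤ.*-identityʳ (+ n)))) (∣ᵤ⇒∣ p∣n))
          ε (λ x y xy≡ε → trans
              (cong (_∙ x) (trans (sym (\\-leftDividesʳ x y)) (trans (cong (x ⁻¹ ∙_) xy≡ε) (identityʳ _))))
              (inverseˡ x)))

    Commutative : Set
    Commutative = ∀ x y → x ∙ y ≡ y ∙ x

    module _ {p} (pPrime : Prime p) (comm : Commutative) (torsionFree : ∀ {x} → power group p x ≡ ε → x ≡ ε) where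

      power-injective : ∀ {x y} → power group p x ≡ power group p y → x ≡ y
      power-injective {x} {y} eq = GroupProperties.x∙y⁻¹≈ε⇒x≈y group x y (torsionFree
        (∙-cancelʳ (power group p y) _ _ (begin
          power group p (x ∙ y ⁻¹) ∙ power group p y  ≡⟨ power-∙ group p y (comm (x ∙ y ⁻¹)) ⟨
          power group p (x ∙ y ⁻¹ ∙ y)                ≡⟨ cong (power group p) (//-rightDividesˡ y x) ⟩
          power group p x                             ≡⟨ eq ⟩
          power group p y                             ≡⟨ identityˡ _ ⟨
          ε ∙ power group p y                         ∎)))

      -- At cᵖ the sum in `frobenius` collapses to the term b(c)ᵖ, by injectivity of the p-th power
      -- map.
      convolution-reduced : ∀ b → (∀ c → + p ∣ selfConvolution b c) → ∀ c → + p ∣ b c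
      convolution-reduced b p∣b*b c = weight-replicate-∣ b c pPrime p (subst (+ p ∣_)
        (trans (sum-cong λ x → cong (_* weight b (replicate p x))
            (indicator-⇔ (power group p x Fin.≟ power group p c) (x Fin.≟ c) power-injective (cong (power group p))))
          (sum-indicator c (λ x → weight b (replicate p x))))
        (frobenius pPrime b p∣b*b (power group p c) (λ x y eq → trans (comm y x) eq)))

      -- The hypothesis is written with n m instead of v because in this form it passes to b / p and
      -- m / p², so that the argument can be repeated until p no longer divides m.
      descent : ∀ {c₀} → c₀ ≢ ε → ∀ m → .{{ℕ.NonZero m}} → ∀ b →
        (∀ c → selfConvolution b c ≡ + m - + (n ℕ.* m) * indicator (c Fin.≟ ε)) → EvenValuation p m
      descent {c₀} c₀≢ε m = go m (ℕ.<-wellFounded m)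
        where
        pp : ℕ
        pp = p ℕ.* p
        instance
          p≢0 = prime⇒nonZero pPrime
          pp≢0 : ℕ.NonZero pp
          pp≢0 = ℕ.m*n≢0 p p
        1<pp : 1 < pp
        1<pp = ℕ.<-≤-trans (ℕ.nonTrivial⇒n>1 p {{prime⇒nonTrivial pPrime}}) (ℕ.m≤m*n p p)
        go : ∀ m → Acc _<_ m → .{{ℕ.NonZero m}} → ∀ b →
             (∀ c → selfConvolution b c ≡ + m - + (n ℕ.* m) * indicator (c Fin.≟ ε)) → EvenValuation p m
        go m (acc rec) b b*b with p ℕ.∣? m
        ... | no p∤m = 0 , m , sym (ℕ.+-identityʳ m) , p∤m
        ... | yes p∣m = lift (go m′ (rec m′<m) b′ b′*b′)
          where
          p∣b : ∀ c → + p ∣ b c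
          p∣b = convolution-reduced b λ c → subst (+ p ∣_) (sym (b*b c))
            (∣m∣n⇒∣m-n {m = + m} (∣ᵤ⇒∣ p∣m)
              (∣m⇒∣m*n {m = + (n ℕ.* m)} (indicator (c Fin.≟ ε)) (∣ᵤ⇒∣ (ℕ.∣n⇒∣m*n n p∣m))))
          b′ : Fin n → ℤ
          b′ c = _∣_.quotient (p∣b c)
          rescale : ∀ x y q → (x * q) * (y * q) ≡ (q * q) * (x * y)
          rescale = solve-∀
          scaled : ∀ c → selfConvolution b c ≡ + pp * selfConvolution b′ c
          scaled c = begin
            selfConvolution b c
              ≡⟨ (sum-cong λ x → trans (cong₂ _*_ (_∣_.equality (p∣b x)) (_∣_.equality (p∣b (x ⁻¹ ∙ c))))
                   (trans (rescale (b′ x) (b′ (x ⁻¹ ∙ c)) (+ p))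
                     (cong (λ q → q * (b′ x * b′ (x ⁻¹ ∙ c))) (sym (ℤ.pos-* p p))))) ⟩
            ∑[ x < n ] (+ pp * (b′ x * b′ (x ⁻¹ ∙ c)))
              ≡⟨ sum-*ˡ (+ pp) (λ x → b′ x * b′ (x ⁻¹ ∙ c)) ⟩
            + pp * selfConvolution b′ c ∎
          -- Away from ε the coefficient of b * b is m itself, and it is p² times an integer.
          atc₀ : + m ≡ + pp * selfConvolution b′ c₀
          atc₀ = begin
            + m                                    ≡⟨ ℤ.+-identityʳ _ ⟨
            + m - 0ℤ                               ≡⟨ cong (λ z → + m - z) (ℤ.*-zeroʳ (+ (n ℕ.* m))) ⟨
            + m - + (n ℕ.* m) * 0ℤ                
              ≡⟨ cong (λ z → + m - + (n ℕ.* m) * z) (indicator-no (c₀ Fin.≟ ε) c₀≢ε) ⟨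
            + m - + (n ℕ.* m) * indicator (c₀ Fin.≟ ε) ≡⟨ b*b c₀ ⟨
            selfConvolution b c₀                     ≡⟨ scaled c₀ ⟩
            + pp * selfConvolution b′ c₀            ∎
          pp∣m : pp ℕ.∣ m
          pp∣m = ∣⇒∣ᵤ (divides (selfConvolution b′ c₀) (trans atc₀ (ℤ.*-comm (+ pp) _)))
          m′ = ℕ.quotient pp∣m
          m≡ : m ≡ m′ ℕ.* pp
          m≡ = ℕ._∣_.equality pp∣m
          instance
            m′≢0 : ℕ.NonZero m′
            m′≢0 = ℕ.≢-nonZero λ m′≡0 → ℕ.≢-nonZero⁻¹ m (trans m≡ (cong (ℕ._* pp) m′≡0))
          m′<m : m′ < m
          m′<m = subst (m′ <_) (sym m≡) (ℕ.m<m*n m′ pp 1<pp)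
          b′*b′ : ∀ c → selfConvolution b′ c ≡ + m′ - + (n ℕ.* m′) * indicator (c Fin.≟ ε)
          b′*b′ c = let i = indicator (c Fin.≟ ε) in
            ℤ.*-cancelˡ-≡ (+ pp) (selfConvolution b′ c) (+ m′ - + (n ℕ.* m′) * i) (begin
            + pp * selfConvolution b′ c      ≡⟨ scaled c ⟨
            selfConvolution b c               ≡⟨ b*b c ⟩
            + m - + (n ℕ.* m) * i
              ≡⟨ cong₂ (λ x y → x - y * i) (trans (cong +_ m≡) (ℤ.pos-* m′ pp))
                   (trans (cong +_ (trans (cong (n ℕ.*_) m≡) (sym (ℕ.*-assoc n m′ pp)))) (ℤ.pos-* (n ℕ.* m′) pp)) ⟩
            + m′ * + pp - + (n ℕ.* m′) * + pp * i  ≡⟨ factor (+ m′) (+ (n ℕ.* m′)) (+ pp) i ⟩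
            + pp * (+ m′ - + (n ℕ.* m′) * i) ∎)
            where
            factor : ∀ m k q i → m * q - k * q * i ≡ q * (m - k * i)
            factor = solve-∀
          lift : EvenValuation p m′ → EvenValuation p m
          lift (s , u , m′≡ , p∤u) = suc s , u , trans m≡ (trans (cong (ℕ._* pp) m′≡) (regroup (p ℕ.^ s) u p)) , p∤u
            where
            regroup : ∀ q u p → q ℕ.* q ℕ.* u ℕ.* (p ℕ.* p) ≡ (p ℕ.* q) ℕ.* (p ℕ.* q) ℕ.* u
            regroup = ℕSolver.solve-∀

open FiniteGroups

-- Enumeration of quotients, and push-forward along a homomorphism.

module Pushforward where
  open import Data.Fin.Base using (Fin; zero; suc)
  import Data.Fin.Properties as Fin
  open import Data.Integer.Base using (ℤ; +_; _+_; _*_; _-_; -_; 1ℤ)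
  import Data.Integer.Base as ℤ
  import Data.Integer.Properties as ℤ
  open import Data.Integer.Tactic.RingSolver using (solve-∀)
  open import Data.Nat.Base using (ℕ; zero; suc)
  import Data.Nat.Base as ℕ
  open import Data.Product.Base using (Σ; _×_; ∃-syntax; _,_; proj₁; proj₂)
  open import Function.Base using (_∘_)
  open import Function.Bundles using (Inverse)
  open import Relation.Binary.Bundles using (Setoid)
  open import Relation.Binary.Definitions using (Decidable)
  open import Relation.Binary.PropositionalEquality hiding (decSetoid)
  open import Relation.Nullary.Decidable using (Dec; yes; no)
  open import Relation.Nullary.Negation.Core using (contradiction)
  open ≡-Reasoning

  module Enumeration {c ℓ n} {S : Setoid c ℓ} (enum : HasSize S n) where
    open Setoid S using (Carrier; _≈_)
    open Inverse enum public using (to; from; to-cong)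

    to-from : ∀ i → to (from i) ≡ i
    to-from i = Inverse.inverseˡ enum (Setoid.refl S)

    from-to : ∀ x → from (to x) ≈ x
    from-to x = Inverse.inverseʳ enum refl

    to-injective : ∀ {x y} → to x ≡ to y → x ≈ y
    to-injective {x} {y} eq = Setoid.trans S (Setoid.sym S (from-to x)) (Inverse.inverseʳ enum eq)

  -- Besides making equality decidable, the transport brings G from arbitrary universe levels to
  -- level zero, where the quotient constructions live.
  finGroup : ∀ {c ℓ n} (G : Group c ℓ) → HasOrder G n → FinGroup n
  finGroup G enum = record
    { _∙_ = λ i j → to (from i ∙ from j)
    ; ε = to ε
    ; _⁻¹ = λ i → to (from i ⁻¹)
    ; isGroup = record
      { isMonoid = record
        { isSemigroup = record
          { isMagma = record { isEquivalence = isEquivalence ; ∙-cong = cong₂ (λ i j → to (from i ∙ from j)) }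
          ; assoc = λ i j k → to-cong (G.trans (∙-congʳ (from-to _))
              (G.trans (G.assoc _ _ _) (∙-congˡ (G.sym (from-to _)))))
          }
        ; identity = (λ i → trans (to-cong (G.trans (∙-congʳ (from-to ε)) (identityˡ _))) (to-from i))
                   , (λ i → trans (to-cong (G.trans (∙-congˡ (from-to ε)) (identityʳ _))) (to-from i))
        }
      ; inverse = (λ i → to-cong (G.trans (∙-congʳ (from-to _)) (inverseˡ _)))
                , (λ i → to-cong (G.trans (∙-congˡ (from-to _)) (inverseʳ _)))
      ; ⁻¹-cong = cong (λ i → to (from i ⁻¹))
      }
    }
    where
    module G = Group G
    open Group G using (_∙_; ε; _⁻¹; ∙-congˡ; ∙-congʳ; identityˡ; identityʳ; inverseˡ; inverseʳ)
    open Enumeration enum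

  module _ {c ℓ} (S : Setoid c ℓ) (_≈?_ : Decidable (Setoid._≈_ S)) where
    open Setoid S using (Carrier; _≈_)

    -- A quotient of a group on `Fin v` keeps its carrier, so the obvious enumeration may repeat
    -- elements. The first one is kept only if it differs from all representatives chosen in the
    -- tail.
    deduplicate : ∀ {v} (e : Fin v → Carrier) →
      ∃[ n ] Σ (Fin n → Carrier) λ e′ → (∀ {i j} → e′ i ≈ e′ j → i ≡ j) × (∀ i → ∃[ j ] e′ j ≈ e i)
    deduplicate {zero}  e = 0 , (λ ()) , (λ { {()} }) , λ ()
    deduplicate {suc v} e with deduplicate (e ∘ suc)
    ... | n , e′ , inj , covers with Fin.any? (λ j → e′ j ≈? e zero)
    ... | yes hit = n , e′ , inj , λ { zero → hit ; (suc i) → covers i }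
    ... | no miss = suc n , e″ , inj″ ,
      λ { zero → zero , Setoid.refl S ; (suc i) → suc (proj₁ (covers i)) , proj₂ (covers i) }
      where
      e″ : Fin (suc n) → Carrier
      e″ zero    = e zero
      e″ (suc j) = e′ j
      inj″ : ∀ {i j} → e″ i ≈ e″ j → i ≡ j
      inj″ {zero}  {zero}  _  = refl
      inj″ {zero}  {suc j} eq = contradiction (j , Setoid.sym S eq) miss
      inj″ {suc i} {zero}  eq = contradiction (i , eq) miss
      inj″ {suc i} {suc j} eq = cong suc (inj eq)

    surjection⇒finite : ∀ {v} (e : Fin v → Carrier) → (∀ x → ∃[ i ] e i ≈ x) → ∃[ n ] HasSize S n
    surjection⇒finite e surj with n , e′ , inj , covers ← deduplicate e = n , record
      { to = index
      ; from = e′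
      ; to-cong = λ {x} {y} x≈y → inj (Setoid.trans S (index-≈ x) (Setoid.trans S x≈y (Setoid.sym S (index-≈ y))))
      ; from-cong = λ { refl → Setoid.refl S }
      ; inverse = (λ {i} {x} x≈e′i → inj (Setoid.trans S (index-≈ x) x≈e′i))
                , λ { {x} refl → index-≈ x }
      }
      where
      module _ (x : Carrier) where
        index : Fin _
        index = proj₁ (covers (proj₁ (surj x)))
        index-≈ : e′ index ≈ x
        index-≈ = Setoid.trans S (proj₂ (covers (proj₁ (surj x)))) (proj₂ (surj x))

  sum-nonNegative : ∀ {n} {f : Fin n → ℤ} → (∀ i → ∃[ m ] f i ≡ + m) → ∃[ m ] sum n f ≡ + m
  sum-nonNegative {zero}  h = 0 , sum-empty
  sum-nonNegative {suc n} h with h zero | sum-nonNegative (h ∘ suc)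
  ... | m , f₀ | k , s = m ℕ.+ k , trans sum-suc (cong₂ _+_ f₀ s)

  indicator-nonNegative : ∀ {a} {A : Set a} (d : Dec A) → ∃[ m ] indicator d ≡ + m
  indicator-nonNegative (yes _) = 1 , refl
  indicator-nonNegative (no _)  = 0 , refl

  module _ {v n} (G : FinGroup v) (A : FinGroup n) (φ : Fin v → Fin n)
    (homo : ∀ x y → φ (FinGroup._∙_ G x y) ≡ FinGroup._∙_ A (φ x) (φ y))
    (surjective : ∀ a → ∃[ x ] φ x ≡ a) where

    private
      module G = FinGroup G
      module A = FinGroup A
      open FinGroup G using () renaming (_∙_ to _∙ᴳ_; _⁻¹ to _⁻¹ᴳ)
      open FinGroup A using (_∙_; _⁻¹)

    φ-ε : φ G.ε ≡ A.ε
    φ-ε = A.∙-cancelˡ (φ G.ε) _ _ (trans (sym (homo _ _)) (trans (cong φ (G.identityˡ G.ε)) (sym (A.identityʳ _))))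

    φ-shift : ∀ g x → φ (g ⁻¹ᴳ ∙ᴳ x) ≡ φ g ⁻¹ ∙ φ x
    φ-shift g x = A.∙-cancelˡ (φ g) _ _ (begin
      φ g ∙ φ (g ⁻¹ᴳ ∙ᴳ x)       ≡⟨ homo _ _ ⟨
      φ (g ∙ᴳ (g ⁻¹ᴳ ∙ᴳ x))      ≡⟨ cong φ (G.\\-leftDividesˡ g x) ⟩
      φ x                        ≡⟨ A.\\-leftDividesˡ (φ g) (φ x) ⟨
      φ g ∙ (φ g ⁻¹ ∙ φ x)       ∎)

    fibre : Fin n → ℤ
    fibre c = ∑[ x < v ] indicator (c Fin.≟ φ x)

    indicator-shift : ∀ g x c → indicator (φ g ⁻¹ ∙ c Fin.≟ φ (g ⁻¹ᴳ ∙ᴳ x)) ≡ indicator (c Fin.≟ φ x)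
    indicator-shift g x c = indicator-⇔ (φ g ⁻¹ ∙ c Fin.≟ φ (g ⁻¹ᴳ ∙ᴳ x)) (c Fin.≟ φ x)
      (λ eq → A.∙-cancelˡ (φ g ⁻¹) _ _ (trans eq (φ-shift g x)))
      (λ { refl → sym (φ-shift g x) })

    -- Left translation by g⁻¹ maps the fibre over φ(g) bijectively onto the fibre over ε.
    fibre-const : ∀ c → fibre c ≡ fibre A.ε
    fibre-const c with g , refl ← surjective c = begin
      ∑[ x < v ] indicator (φ g Fin.≟ φ x)
        ≡⟨ (sum-cong λ x → indicator-shift g x (φ g)) ⟨
      ∑[ x < v ] indicator (φ g ⁻¹ ∙ φ g Fin.≟ φ (g ⁻¹ᴳ ∙ᴳ x))
        ≡⟨ sum-cong (λ x → cong (λ a → indicator (a Fin.≟ φ (g ⁻¹ᴳ ∙ᴳ x))) (A.inverseˡ (φ g))) ⟩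
      ∑[ x < v ] indicator (A.ε Fin.≟ φ (g ⁻¹ᴳ ∙ᴳ x))
        ≡⟨ G.sum-translate (g ⁻¹ᴳ) {λ x → indicator (A.ε Fin.≟ φ x)} ⟨
      fibre A.ε ∎

    fibreSize : ∃[ m ] (v ≡ n ℕ.* m × ∀ c → fibre c ≡ + m)
    fibreSize with m , fibre≡m ← sum-nonNegative (λ x → indicator-nonNegative (A.ε Fin.≟ φ x)) =
      m , ℤ.+-injective (begin
        + v                          ≡⟨ ℤ.*-identityʳ (+ v) ⟨
        + v * 1ℤ                     ≡⟨ sum-const v 1ℤ ⟨
        ∑[ x < v ] 1ℤ                ≡⟨ (sum-cong λ x → sum-indicator (φ x) (λ _ → 1ℤ)) ⟨
        ∑[ x < v ] (∑[ c < n ] (indicator (c Fin.≟ φ x) * 1ℤ))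
          ≡⟨ (sum-cong λ x → sum-cong λ c → ℤ.*-identityʳ (indicator (c Fin.≟ φ x))) ⟩
        ∑[ x < v ] (∑[ c < n ] indicator (c Fin.≟ φ x)) ≡⟨ sum-comm ⟩
        ∑[ c < n ] fibre c           ≡⟨ sum-cong (λ c → trans (fibre-const c) fibre≡m) ⟩
        ∑[ c < n ] (+ m)             ≡⟨ sum-const n (+ m) ⟩
        + n * + m                    ≡⟨ ℤ.pos-* n m ⟨
        + (n ℕ.* m)                  ∎)
      , λ c → trans (fibre-const c) fibre≡m

    -- The image of f under the ring homomorphism ℤ[G] → ℤ[A] induced by φ.
    pushforward : (Fin v → ℤ) → Fin n → ℤ
    pushforward f c = ∑[ x < v ] (indicator (c Fin.≟ φ x) * f x)

    pushforward-convolution : ∀ f c → A.selfConvolution (pushforward f) c ≡ pushforward (G.selfConvolution f) c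
    pushforward-convolution f c = begin
      ∑[ a < n ] (b a * b (a ⁻¹ ∙ c))
        ≡⟨ (sum-cong λ a → sum-*ʳ (b (a ⁻¹ ∙ c)) (λ x → indicator (a Fin.≟ φ x) * f x)) ⟨
      ∑[ a < n ] (∑[ x < v ] (indicator (a Fin.≟ φ x) * f x * b (a ⁻¹ ∙ c)))
        ≡⟨ sum-comm ⟩
      ∑[ x < v ] (∑[ a < n ] (indicator (a Fin.≟ φ x) * f x * b (a ⁻¹ ∙ c)))
        ≡⟨ (sum-cong λ x → trans
             (sum-cong λ a → ℤ.*-assoc (indicator (a Fin.≟ φ x)) (f x) (b (a ⁻¹ ∙ c)))
             (sum-indicator (φ x) (λ a → f x * b (a ⁻¹ ∙ c)))) ⟩
      ∑[ x < v ] (f x * b (φ x ⁻¹ ∙ c))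
        -- Substituting y = x⁻¹ g turns φ(x)⁻¹ c = φ(y) into c = φ(g), a condition free of x.
        ≡⟨ (sum-cong λ x → cong (f x *_) (trans
             (G.sum-translate (x ⁻¹ᴳ) {λ y → indicator (φ x ⁻¹ ∙ c Fin.≟ φ y) * f y})
             (sum-cong λ g → cong (_* f (x ⁻¹ᴳ ∙ᴳ g)) (indicator-shift x g c)))) ⟩
      ∑[ x < v ] (f x * ∑[ g < v ] (indicator (c Fin.≟ φ g) * f (x ⁻¹ᴳ ∙ᴳ g)))
        ≡⟨ (sum-cong λ x → sum-*ˡ (f x) (λ g → indicator (c Fin.≟ φ g) * f (x ⁻¹ᴳ ∙ᴳ g))) ⟨
      ∑[ x < v ] (∑[ g < v ] (f x * (indicator (c Fin.≟ φ g) * f (x ⁻¹ᴳ ∙ᴳ g))))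
        ≡⟨ sum-comm ⟩
      ∑[ g < v ] (∑[ x < v ] (f x * (indicator (c Fin.≟ φ g) * f (x ⁻¹ᴳ ∙ᴳ g))))
        ≡⟨ (sum-cong λ g → trans
             (sum-cong λ x → exchange (f x) (indicator (c Fin.≟ φ g)) (f (x ⁻¹ᴳ ∙ᴳ g)))
             (sum-*ˡ (indicator (c Fin.≟ φ g)) (λ x → f x * f (x ⁻¹ᴳ ∙ᴳ g)))) ⟩
      pushforward (G.selfConvolution f) c ∎
      where
      b = pushforward f
      exchange : ∀ x y z → x * (y * z) ≡ y * (x * z)
      exchange = solve-∀

    -- The image of 1_G has the fibre sizes as coefficients, and the image of 1_ε is 1_ε.
    pushforward-shds : ∀ {f} → (∀ g → G.selfConvolution f g ≡ 1ℤ - + v * indicator (g Fin.≟ G.ε)) →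
      ∀ c → A.selfConvolution (pushforward f) c ≡ fibre c - + v * indicator (c Fin.≟ A.ε)
    pushforward-shds {f} f*f c = begin
      A.selfConvolution (pushforward f) c
        ≡⟨ pushforward-convolution f c ⟩
      ∑[ g < v ] (indicator (c Fin.≟ φ g) * G.selfConvolution f g)
        ≡⟨ (sum-cong λ g → trans (cong (indicator (c Fin.≟ φ g) *_) (f*f g))
             (expand (indicator (c Fin.≟ φ g)) (+ v) (indicator (g Fin.≟ G.ε)))) ⟩
      ∑[ g < v ] (indicator (c Fin.≟ φ g) + - + v * (indicator (g Fin.≟ G.ε) * indicator (c Fin.≟ φ g)))
        ≡⟨ sum-+ ⟩
      fibre c + ∑[ g < v ] (- + v * (indicator (g Fin.≟ G.ε) * indicator (c Fin.≟ φ g)))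
        ≡⟨ cong (λ z → fibre c + z) (begin
             ∑[ g < v ] (- + v * (indicator (g Fin.≟ G.ε) * indicator (c Fin.≟ φ g)))
               ≡⟨ sum-*ˡ (- + v) (λ g → indicator (g Fin.≟ G.ε) * indicator (c Fin.≟ φ g)) ⟩
             - + v * ∑[ g < v ] (indicator (g Fin.≟ G.ε) * indicator (c Fin.≟ φ g))
               ≡⟨ cong (- + v *_) (sum-indicator G.ε (λ g → indicator (c Fin.≟ φ g))) ⟩
             - + v * indicator (c Fin.≟ φ G.ε)
               ≡⟨ cong (λ a → - + v * indicator (c Fin.≟ a)) φ-ε ⟩
             - + v * indicator (c Fin.≟ A.ε)
               ≡⟨ ℤ.neg-distribˡ-* (+ v) (indicator (c Fin.≟ A.ε)) ⟨
             - (+ v * indicator (c Fin.≟ A.ε)) ∎) ⟩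
      fibre c - + v * indicator (c Fin.≟ A.ε) ∎
      where
      expand : ∀ i v d → i * (1ℤ - v * d) ≡ i + - v * (d * i)
      expand = solve-∀

open Pushforward

-- The convolution square of an odd function with values ±1 off the identity.

module DifferenceSets where
  import Algebra.Properties.Group as GroupProperties
  open import Data.Fin.Base using (Fin; zero)
  import Data.Fin.Properties as Fin
  open import Data.Integer.Base using (ℤ; +_; _+_; _*_; _-_; -_; 0ℤ; 1ℤ; -1ℤ)
  import Data.Integer.Base as ℤ
  import Data.Integer.Properties as ℤ
  open import Data.Integer.Tactic.RingSolver using (solve-∀)
  open import Data.Nat.Base using (ℕ; zero; _<_)
  import Data.Nat.Base as ℕ
  import Data.Nat.Properties as ℕ
  open import Data.Product.Base using (Σ; _×_; ∃-syntax; _,_; proj₁; proj₂)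
  open import Data.Sum.Base using (_⊎_; inj₁; inj₂)
  open import Function.Base using (_∘_)
  open import Relation.Binary.PropositionalEquality hiding (decSetoid)
  open import Relation.Nullary.Decidable using (yes; no)
  open import Relation.Nullary.Negation.Core using (contradiction)
  open import Relation.Unary using (Pred)
  open ≡-Reasoning

  module _ {v} (F : FinGroup v) where
    open FinGroup F

    δ : Fin v → ℤ
    δ x = indicator (x Fin.≟ ε)

    -- For h = 1_D this counts the pairs d₁ = g x, d₂ = x in D, that is, the representations g = d₁
    -- d₂⁻¹.
    correlation : (Fin v → ℤ) → Fin v → ℤ
    correlation h g = ∑[ x < v ] (h (g ∙ x) * h x)

    module _ (f : Fin v → ℤ) where
      -- Since 1_D + 1_{D⁻¹} = 1 - δ, this is 2 · 1_D when f = 1_D - 1_{D⁻¹}; the doubling keeps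
      -- fractions out.
      doubled : Fin v → ℤ
      doubled x = f x + 1ℤ - δ x

      module _ (odd : ∀ x → f (x ⁻¹) ≡ - f x) (square : ∀ x → f x * f x ≡ 1ℤ - δ x) where

        sum-δ : sum v δ ≡ 1ℤ
        sum-δ = trans (sum-cong λ x → sym (ℤ.*-identityʳ (δ x))) (sum-indicator ε (λ _ → 1ℤ))

        sum-odd : sum v f ≡ 0ℤ
        sum-odd = self-negative (sum v f) (begin
          sum v f                    ≡⟨ sum-invert ⟩
          ∑[ x < v ] (f (x ⁻¹))      ≡⟨ sum-cong (λ x → trans (odd x) (sym (ℤ.-1*i≡-i (f x)))) ⟩
          ∑[ x < v ] (-1ℤ * f x)     ≡⟨ sum-*ˡ -1ℤ f ⟩
          -1ℤ * sum v f              ≡⟨ ℤ.-1*i≡-i (sum v f) ⟩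
          - sum v f                  ∎)
          where
          self-negative : ∀ z → z ≡ - z → z ≡ 0ℤ
          self-negative (+ zero) _ = refl

        -- Oddness turns f(x⁻¹ g) into - f(g⁻¹ x), so the convolution becomes a correlation, which
        -- is what the difference set axiom controls.
        selfConvolution-correlation : ∀ g → selfConvolution f g ≡ - correlation f (g ⁻¹)
        selfConvolution-correlation g = begin
          ∑[ x < v ] (f x * f (x ⁻¹ ∙ g))
            ≡⟨ (sum-cong λ x → trans (cong (f x *_) (trans (cong f (flip-inverse x)) (odd (g ⁻¹ ∙ x))))
                 (negate (f x) (f (g ⁻¹ ∙ x)))) ⟩
          ∑[ x < v ] (-1ℤ * (f (g ⁻¹ ∙ x) * f x))
            ≡⟨ sum-*ˡ -1ℤ (λ x → f (g ⁻¹ ∙ x) * f x) ⟩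
          -1ℤ * correlation f (g ⁻¹)
            ≡⟨ ℤ.-1*i≡-i (correlation f (g ⁻¹)) ⟩
          - correlation f (g ⁻¹) ∎
          where
          flip-inverse : ∀ x → x ⁻¹ ∙ g ≡ (g ⁻¹ ∙ x) ⁻¹
          flip-inverse x = sym (trans (⁻¹-anti-homo-∙ (g ⁻¹) x) (cong (x ⁻¹ ∙_) (⁻¹-involutive g)))
          negate : ∀ a b → a * - b ≡ -1ℤ * (b * a)
          negate = solve-∀

        correlation-ε : correlation f ε ≡ + v - 1ℤ
        correlation-ε = begin
          ∑[ x < v ] (f (ε ∙ x) * f x)
            ≡⟨ (sum-cong λ x → trans (cong (λ y → f y * f x) (identityˡ x))
                 (trans (square x) (cong (λ z → 1ℤ + z) (sym (ℤ.-1*i≡-i (δ x)))))) ⟩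
          ∑[ x < v ] (1ℤ + -1ℤ * δ x)      ≡⟨ sum-+ ⟩
          ∑[ x < v ] 1ℤ + ∑[ x < v ] (-1ℤ * δ x)
            ≡⟨ cong₂ _+_ (trans (sum-const v 1ℤ) (ℤ.*-identityʳ (+ v)))
                 (trans (sum-*ˡ -1ℤ δ) (cong (-1ℤ *_) sum-δ)) ⟩
          + v - 1ℤ                         ∎

        -- The constant is v from 1 · 1 and -1 from each of the two terms 1 · δ; the product of the
        -- two δ vanishes as g ≠ ε. The terms linear in f sum to 0, and those combining f and δ give
        -- - f(g) and - f(g⁻¹), which cancel.
        correlation-doubled : ∀ {g} → g ≢ ε → correlation doubled g ≡ correlation f g + (+ v - + 2)
        correlation-doubled {g} g≢ε = begin
          ∑[ x < v ] (doubled (g ∙ x) * doubled x)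
            ≡⟨ (sum-cong λ x → expand (f (g ∙ x)) (δ (g ∙ x)) (f x) (δ x)) ⟩
          ∑[ x < v ] ((f (g ∙ x) * f x + f (g ∙ x) + -1ℤ * (δ x * f (g ∙ x))) +
                      (f x + 1ℤ + -1ℤ * δ x + -1ℤ * (δ (g ∙ x) * doubled x)))
            ≡⟨ trans sum-+ (cong₂ _+_ (trans sum-+ (cong₂ _+_ sum-+ (sum-*ˡ -1ℤ (λ x → δ x * f (g ∙ x)))))
                 (trans sum-+ (cong₂ _+_ (trans sum-+ (cong₂ _+_ sum-+ (sum-*ˡ -1ℤ δ)))
                   (sum-*ˡ -1ℤ (λ x → δ (g ∙ x) * doubled x))))) ⟩
          (correlation f g + ∑[ x < v ] (f (g ∙ x)) + -1ℤ * ∑[ x < v ] (δ x * f (g ∙ x))) +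
          (sum v f + ∑[ x < v ] 1ℤ + -1ℤ * sum v δ + -1ℤ * ∑[ x < v ] (δ (g ∙ x) * doubled x))
            ≡⟨ cong₂ _+_
                 (cong₂ (λ s t → correlation f g + s + -1ℤ * t)
                   (trans (sym (sum-translate g)) sum-odd)
                   (trans (sum-indicator ε (λ x → f (g ∙ x))) (cong f (identityʳ g))))
                 (cong₂ (λ s t → s + -1ℤ * t)
                   (cong₂ (λ s t → s + -1ℤ * t)
                     (cong₂ _+_ sum-odd (trans (sum-const v 1ℤ) (ℤ.*-identityʳ (+ v)))) sum-δ)
                   shifted) ⟩
          (correlation f g + 0ℤ + -1ℤ * f g) + (0ℤ + + v + -1ℤ * 1ℤ + -1ℤ * (- f g + 1ℤ - 0ℤ))
            ≡⟨ collect (correlation f g) (f g) (+ v) ⟩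
          correlation f g + (+ v - + 2) ∎
          where
          expand : ∀ a d b e → (a + 1ℤ - d) * (b + 1ℤ - e) ≡
            (a * b + a + -1ℤ * (e * a)) + (b + 1ℤ + -1ℤ * e + -1ℤ * (d * (b + 1ℤ - e)))
          expand = solve-∀
          collect : ∀ r a v → (r + 0ℤ + -1ℤ * a) + (0ℤ + v + -1ℤ * 1ℤ + -1ℤ * (- a + 1ℤ - 0ℤ)) ≡ r + (v - + 2)
          collect = solve-∀
          g⁻¹≢ε : g ⁻¹ ≢ ε
          g⁻¹≢ε eq = g≢ε (trans (sym (⁻¹-involutive g)) (trans (cong _⁻¹ eq) ε⁻¹≈ε))
          shifted : ∑[ x < v ] (δ (g ∙ x) * doubled x) ≡ - f g + 1ℤ - 0ℤ
          shifted = begin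
            ∑[ x < v ] (δ (g ∙ x) * doubled x)
              ≡⟨ (sum-cong λ x → cong (λ y → δ (g ∙ x) * doubled y) (\\-leftDividesʳ g x)) ⟨
            ∑[ x < v ] (δ (g ∙ x) * doubled (g ⁻¹ ∙ (g ∙ x)))
              ≡⟨ sum-translate g {λ y → δ y * doubled (g ⁻¹ ∙ y)} ⟨
            ∑[ y < v ] (δ y * doubled (g ⁻¹ ∙ y))
              ≡⟨ trans (sum-indicator ε (λ y → doubled (g ⁻¹ ∙ y))) (cong doubled (identityʳ (g ⁻¹))) ⟩
            f (g ⁻¹) + 1ℤ - δ (g ⁻¹)
              ≡⟨ cong₂ (λ a d → a + 1ℤ - d) (odd g) (indicator-no (g ⁻¹ Fin.≟ ε) g⁻¹≢ε) ⟩
            - f g + 1ℤ - 0ℤ ∎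

        -- The augmentation is multiplicative, and it is 0 on f.
        sum-selfConvolution : sum v (selfConvolution f) ≡ 0ℤ
        sum-selfConvolution = begin
          ∑[ g < v ] (∑[ x < v ] (f x * f (x ⁻¹ ∙ g)))  ≡⟨ sum-comm ⟩
          ∑[ x < v ] (∑[ g < v ] (f x * f (x ⁻¹ ∙ g)))
            ≡⟨ (sum-cong λ x → trans (sum-*ˡ (f x) (λ g → f (x ⁻¹ ∙ g)))
                 (trans (cong (f x *_) (trans (sym (sum-translate (x ⁻¹))) sum-odd)) (ℤ.*-zeroʳ (f x)))) ⟩
          ∑[ x < v ] 0ℤ                                 ≡⟨ sum-zero (λ _ → refl) ⟩
          0ℤ                                            ∎

        module _ {l} (1<v : 1 < v) (balanced : ∀ {g} → g ≢ ε → correlation doubled g ≡ + 4 * + l) where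

          private
            -- The coefficient of f * f off the identity, read off from `correlation-doubled` and
            -- `balanced`.
            μ : ℤ
            μ = + v - + 2 - + 4 * + l

            selfConvolution-μ : ∀ g → selfConvolution f g ≡ μ + (1ℤ - + v - μ) * δ g
            selfConvolution-μ g with g Fin.≟ ε
            ... | yes refl = trans (selfConvolution-correlation ε)
              (trans (cong (λ y → - correlation f y) ε⁻¹≈ε) (trans (cong -_ correlation-ε) (at-ε (+ v) μ)))
              where
              at-ε : ∀ v m → - (v - 1ℤ) ≡ m + (1ℤ - v - m) * 1ℤ
              at-ε = solve-∀
            ... | no g≢ε = trans (selfConvolution-correlation g)
                (solve-for (correlation f (g ⁻¹)) (+ v) (+ 4 * + l) (1ℤ - + v - μ)
                  (trans (sym (correlation-doubled g⁻¹≢ε)) (balanced g⁻¹≢ε)))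
              where
              g⁻¹≢ε : g ⁻¹ ≢ ε
              g⁻¹≢ε eq = g≢ε (trans (sym (⁻¹-involutive g)) (trans (cong _⁻¹ eq) ε⁻¹≈ε))
              isolate : ∀ r v x → - r ≡ v - + 2 - (r + (v - + 2)) + x * 0ℤ
              isolate = solve-∀
              solve-for : ∀ r v k x → r + (v - + 2) ≡ k → - r ≡ v - + 2 - k + x * 0ℤ
              solve-for r v _ x refl = isolate r v x

            -- Summing the coefficients μ off ε and 1 - v at ε gives 0 = (v - 1)(μ - 1), and v > 1.
            μ≡1 : μ ≡ 1ℤ
            μ≡1 with ℤ.i*j≡0⇒i≡0∨j≡0 (+ v - 1ℤ) product≡0
              where
              factor : ∀ v m → (v - 1ℤ) * (m - 1ℤ) ≡ v * m + (1ℤ - v - m) * 1ℤ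
              factor = solve-∀
              product≡0 : (+ v - 1ℤ) * (μ - 1ℤ) ≡ 0ℤ
              product≡0 = begin
                (+ v - 1ℤ) * (μ - 1ℤ)                                    ≡⟨ factor (+ v) μ ⟩
                + v * μ + (1ℤ - + v - μ) * 1ℤ
                  ≡⟨ cong₂ _+_ (sum-const v μ)
                       (trans (sum-*ˡ (1ℤ - + v - μ) δ) (cong ((1ℤ - + v - μ) *_) sum-δ)) ⟨
                ∑[ g < v ] μ + ∑[ g < v ] ((1ℤ - + v - μ) * δ g)         ≡⟨ sum-+ ⟨
                ∑[ g < v ] (μ + (1ℤ - + v - μ) * δ g)                    ≡⟨ sum-cong selfConvolution-μ ⟨
                sum v (selfConvolution f)                                ≡⟨ sum-selfConvolution ⟩
                0ℤ                                                       ∎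
            ... | inj₁ v-1≡0 = contradiction (sym (ℤ.+-injective (ℤ.i-j≡0⇒i≡j (+ v) 1ℤ v-1≡0))) (ℕ.<⇒≢ 1<v)
            ... | inj₂ μ-1≡0 = ℤ.i-j≡0⇒i≡j μ 1ℤ μ-1≡0

          skewHadamard-convolution : ∀ g → selfConvolution f g ≡ 1ℤ - + v * δ g
          skewHadamard-convolution g = trans (selfConvolution-μ g)
            (trans (cong (λ m → m + (1ℤ - + v - m) * δ g) μ≡1) (simplify (+ v) (δ g)))
            where
            simplify : ∀ v d → 1ℤ + (1ℤ - v - 1ℤ) * d ≡ 1ℤ - v * d
            simplify = solve-∀

          skewHadamard-order : v ≡ 3 ℕ.+ 4 ℕ.* l
          skewHadamard-order = ℤ.+-injective (begin
            + v                       ≡⟨ isolate (+ v) (+ 4 * + l) ⟩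
            μ + + 2 + + 4 * + l       ≡⟨ cong₂ (λ m k → m + + 2 + k) μ≡1 (sym (ℤ.pos-* 4 l)) ⟩
            + (3 ℕ.+ 4 ℕ.* l)         ∎)
            where
            isolate : ∀ v k → v ≡ v - + 2 - k + + 2 + k
            isolate = solve-∀

  sum-image : ∀ {v l} {χ : Fin v → ℤ} (e : Fin l → Fin v) → (∀ {i j} → e i ≡ e j → i ≡ j) →
    (∀ j → χ (e j) ≡ 1ℤ) → (∀ x → χ x ≡ 0ℤ ⊎ ∃[ j ] e j ≡ x) → sum v χ ≡ + l
  sum-image {v} {l} {χ} e inj onImage classify = begin
    sum v χ                                                     ≡⟨ sum-cong expand ⟩
    ∑[ x < v ] (∑[ j < l ] (indicator (x Fin.≟ e j) * 1ℤ))      ≡⟨ sum-comm ⟩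
    ∑[ j < l ] (∑[ x < v ] (indicator (x Fin.≟ e j) * 1ℤ))      ≡⟨ sum-cong (λ j → sum-indicator (e j) (λ _ → 1ℤ)) ⟩
    ∑[ j < l ] 1ℤ                                               ≡⟨ sum-const l 1ℤ ⟩
    + l * 1ℤ                                                    ≡⟨ ℤ.*-identityʳ (+ l) ⟩
    + l                                                         ∎
    where
    expand : ∀ x → χ x ≡ ∑[ j < l ] (indicator (x Fin.≟ e j) * 1ℤ)
    expand x with classify x
    ... | inj₁ χx≡0 = trans χx≡0 (sym (sum-zero λ j → cong (_* 1ℤ)
            (indicator-no (x Fin.≟ e j) λ { refl → contradiction (trans (sym (onImage j)) χx≡0) λ () })))
    ... | inj₂ (i , refl) = trans (onImage i) (sym (trans
            (sum-cong λ j → cong (_* 1ℤ) (indicator-⇔ (e i Fin.≟ e j) (j Fin.≟ i) (sym ∘ inj) (λ { refl → refl })))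
            (sum-indicator i (λ _ → 1ℤ))))

  -- From a skew-Hadamard difference set to the function f.

  module SkewHadamard {c ℓ d} (G : Group c ℓ) {D : Pred (Group.Carrier G) d} (shds : IsSkewHadamard G D)
    {v k l} (differenceSet : IsDifferenceSet G D v k l) where
    private module G = Group G
    open Group G using (Carrier; _≈_; _∙_; ε; _⁻¹; ∙-congˡ; ∙-congʳ; ⁻¹-cong)
    open GroupProperties G
    open IsSkewHadamard shds using (cover; D⊥D⁻¹; D⊥1; D⁻¹⊥1)
    open IsDifferenceSet differenceSet
    open Enumeration order

    F : FinGroup v
    F = finGroup G order

    private
      module F = FinGroup F

      -- D is an arbitrary predicate, and `cover` serves as its decision procedure. The value is
      -- read off from a proof; the disjointness axioms make it independent of which proof is given,
      -- as the next lemmas show.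
      sign : ∀ {x} → D x ⊎ (Inverses G D x ⊎ x ≈ ε) → ℤ
      sign (inj₁ _)        = 1ℤ
      sign (inj₂ (inj₁ _)) = -1ℤ
      sign (inj₂ (inj₂ _)) = 0ℤ

      sign-D : ∀ {x} → D x → ∀ c → sign {x} c ≡ 1ℤ
      sign-D x∈D (inj₁ _)          = refl
      sign-D x∈D (inj₂ (inj₁ x∈I)) = contradiction (x∈D , x∈I) D⊥D⁻¹
      sign-D x∈D (inj₂ (inj₂ x≈ε)) = contradiction (x∈D , x≈ε) D⊥1

      sign-D⁻¹ : ∀ {x} → Inverses G D x → ∀ c → sign {x} c ≡ -1ℤ
      sign-D⁻¹ x∈I (inj₁ x∈D)        = contradiction (x∈D , x∈I) D⊥D⁻¹
      sign-D⁻¹ x∈I (inj₂ (inj₁ _))   = refl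
      sign-D⁻¹ x∈I (inj₂ (inj₂ x≈ε)) = contradiction (x∈I , x≈ε) D⁻¹⊥1

      sign-ε : ∀ {x} → x ≈ ε → ∀ c → sign {x} c ≡ 0ℤ
      sign-ε x≈ε (inj₁ x∈D)        = contradiction (x∈D , x≈ε) D⊥1
      sign-ε x≈ε (inj₂ (inj₁ x∈I)) = contradiction (x∈I , x≈ε) D⁻¹⊥1
      sign-ε x≈ε (inj₂ (inj₂ _))   = refl

      ≈ε⇒≡ε : ∀ {i} → from i ≈ ε → i ≡ F.ε
      ≈ε⇒≡ε {i} eq = trans (sym (to-from i)) (to-cong eq)

    signature : Fin v → ℤ
    signature i = sign (cover (from i))

    signature-odd : ∀ i → signature (i F.⁻¹) ≡ - signature i
    signature-odd i with cover (from i)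
    ... | inj₁ i∈D = sign-D⁻¹ (from i , i∈D , from-to _) (cover (from (i F.⁻¹)))
    ... | inj₂ (inj₁ (x , x∈D , i≈x⁻¹)) =
      sign-D (respects (G.sym (G.trans (from-to _) (G.trans (⁻¹-cong i≈x⁻¹) (⁻¹-involutive x)))) x∈D)
        (cover (from (i F.⁻¹)))
    ... | inj₂ (inj₂ i≈ε) =
      sign-ε (G.trans (from-to _) (G.trans (⁻¹-cong i≈ε) ε⁻¹≈ε)) (cover (from (i F.⁻¹)))

    signature-square : ∀ i → signature i * signature i ≡ 1ℤ - δ F i
    signature-square i with cover (from i)
    ... | inj₁ i∈D = cong (λ z → 1ℤ - z) (sym (indicator-no (i Fin.≟ F.ε) λ { refl → D⊥1 (i∈D , from-to ε) }))
    ... | inj₂ (inj₁ i∈I) = cong (λ z → 1ℤ - z) (sym (indicator-no (i Fin.≟ F.ε) λ { refl → D⁻¹⊥1 (i∈I , from-to ε) }))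
    ... | inj₂ (inj₂ i≈ε) = cong (λ z → 1ℤ - z) (sym (indicator-yes (i Fin.≟ F.ε) (≈ε⇒≡ε i≈ε)))

    private
      inD : ∀ {x} → D x ⊎ (Inverses G D x ⊎ x ≈ ε) → ℤ
      inD (inj₁ _) = 1ℤ
      inD (inj₂ _) = 0ℤ

      inD-yes : ∀ {x} → D x → ∀ c → inD {x} c ≡ 1ℤ
      inD-yes x∈D (inj₁ _)          = refl
      inD-yes x∈D (inj₂ (inj₁ x∈I)) = contradiction (x∈D , x∈I) D⊥D⁻¹
      inD-yes x∈D (inj₂ (inj₂ x≈ε)) = contradiction (x∈D , x≈ε) D⊥1

    membership : Fin v → ℤ
    membership i = inD (cover (from i))

    doubled-membership : ∀ i → doubled F signature i ≡ + 2 * membership i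
    doubled-membership i with cover (from i)
    ... | inj₁ i∈D = cong (λ z → + 2 - z) (indicator-no (i Fin.≟ F.ε) λ { refl → D⊥1 (i∈D , from-to ε) })
    ... | inj₂ (inj₁ i∈I) = cong (λ z → 0ℤ - z) (indicator-no (i Fin.≟ F.ε) λ { refl → D⁻¹⊥1 (i∈I , from-to ε) })
    ... | inj₂ (inj₂ i≈ε) = cong (λ z → 1ℤ - z) (indicator-yes (i Fin.≟ F.ε) (≈ε⇒≡ε i≈ε))

    -- A pair with quotient g is determined by its second component x, the first being g x. So the λ
    -- pairs correspond to the x for which both x and g x lie in D.
    correlation-membership : ∀ {g} → g ≢ F.ε → correlation F membership g ≡ + l
    correlation-membership {g} g≢ε = sum-image e e-injective onImage classify
      where
      module Q = Enumeration (quotients (from g) (g≢ε ∘ ≈ε⇒≡ε))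
      pair : Fin l → Carrier × Carrier
      pair j = proj₁ (Q.from j)
      pair∈ : ∀ j → Quotients G D (from g) (pair j)
      pair∈ j = proj₂ (Q.from j)
      e : Fin l → Fin v
      e j = to (proj₂ (pair j))
      numerator : ∀ j → from g ∙ proj₂ (pair j) ≈ proj₁ (pair j)
      numerator j with _ , _ , _ , g≈ ← pair∈ j = G.trans (∙-congʳ g≈) (//-rightDividesˡ _ _)
      e-injective : ∀ {i j} → e i ≡ e j → i ≡ j
      e-injective {i} {j} eq = trans (sym (Q.to-from i)) (trans
        (Q.to-cong (G.trans (G.sym (numerator i)) (G.trans (∙-congˡ (to-injective eq)) (numerator j)) , to-injective eq))
        (Q.to-from j))
      onImage : ∀ j → membership (g F.∙ e j) * membership (e j) ≡ 1ℤ
      onImage j with d₁∈D , d₂∈D , _ ← pair∈ j = cong₂ _*_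
        (inD-yes (respects (G.sym (G.trans (from-to _) (G.trans (∙-congˡ (from-to _)) (numerator j)))) d₁∈D)
          (cover (from (g F.∙ e j))))
        (inD-yes (respects (G.sym (from-to _)) d₂∈D) (cover (from (e j))))
      classify : ∀ x → membership (g F.∙ x) * membership x ≡ 0ℤ ⊎ ∃[ j ] e j ≡ x
      classify x with cover (from x) | cover (from (g F.∙ x))
      ... | inj₂ _ | y        = inj₁ (ℤ.*-zeroʳ (inD y))
      ... | inj₁ _ | inj₂ _   = inj₁ refl
      ... | inj₁ x∈D | inj₁ gx∈D = inj₂ (Q.to q , trans (to-cong (proj₂ (Q.from-to q))) (to-from x))
        where
        q : Σ (Carrier × Carrier) (Quotients G D (from g))
        q = (from (g F.∙ x) , from x) , gx∈D , x∈D
          -- The two components differ because g x = x would give g = ε.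
          , (λ eq → g≢ε (≈ε⇒≡ε (identityˡ-unique (from g) (from x) (G.trans (G.sym (from-to _)) eq))))
          , G.sym (G.trans (∙-congʳ (from-to _)) (//-rightDividesʳ (from x) (from g)))

    doubled-balanced : ∀ {g} → g ≢ F.ε → correlation F (doubled F signature) g ≡ + 4 * + l
    doubled-balanced {g} g≢ε = begin
      ∑[ x < v ] (doubled F signature (g F.∙ x) * doubled F signature x)
        ≡⟨ (sum-cong λ x → trans (cong₂ _*_ (doubled-membership (g F.∙ x)) (doubled-membership x))
             (pull (membership (g F.∙ x)) (membership x))) ⟩
      ∑[ x < v ] (+ 4 * (membership (g F.∙ x) * membership x))
        ≡⟨ sum-*ˡ (+ 4) (λ x → membership (g F.∙ x) * membership x) ⟩
      + 4 * correlation F membership g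
        ≡⟨ cong (+ 4 *_) (correlation-membership g≢ε) ⟩
      + 4 * + l ∎
      where
      pull : ∀ a b → + 2 * a * (+ 2 * b) ≡ + 4 * (a * b)
      pull = solve-∀

open DifferenceSets

open import Level using (0ℓ)
open import Data.Fin.Base using (Fin; zero; suc)
import Data.Fin.Properties as Fin
import Data.Integer.Base as ℤ
open import Data.List.Base using ([]; _∷_)
open import Data.List.Relation.Unary.All using ([]; _∷_)
open import Data.Nat.Base using (ℕ; zero; suc; _+_; _*_; _^_; _≤_; _<_; z≤n; s≤s; _⊔_; NonZero)
import Data.Nat.Base as ℕ
import Data.Nat.Properties as ℕ
open import Data.Nat.Divisibility using (_∣_; divides; _∣?_; ∣-trans; m∣m*n; n∣m*n; ∣1⇒≡1; ∣m+n∣m⇒∣n; >⇒∤)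
import Data.Nat.Induction as ℕ
open import Data.Nat.Primality using (prime⇒nonZero; prime⇒nonTrivial; prime⇒irreducible; prime[2]; ¬prime[1]; euclidsLemma)
open import Data.Nat.Primality.Factorisation using (factorise)
open import Data.Nat.Coprimality using (Coprime)
import Data.Nat.Coprimality as Coprime
open import Data.Nat.Tactic.RingSolver using (solve-∀)
open import Data.Product.Base using (_,_; proj₁; proj₂)
open import Data.Sum.Base using (_⊎_; inj₁; inj₂; [_,_]′)
open import Effect.Monad using (RawMonad)
open import Function.Base using (_∘_; id)
open import Induction.WellFounded using (Acc; acc)
open import Relation.Binary.Definitions using (_Respects_)
open import Relation.Binary.PropositionalEquality
open import Relation.Nullary.Decidable using (Dec; yes; no; ¬¬-excluded-middle)
open import Relation.Nullary.Negation using (¬¬-Monad)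
open import Relation.Nullary.Negation.Core using (¬_; contradiction)
open import Relation.Unary using (Pred)
open ≡-Reasoning

-- Primes, even valuations and squares.

primeDivisor : ∀ n → .{{NonZero n}} → n ≢ 1 → ∃[ p ] Prime p × p ∣ n
primeDivisor n n≢1 with factorise n
... | record { factors = []     ; isFactorisation = eq } = contradiction eq n≢1
... | record { factors = p ∷ ps ; isFactorisation = eq ; factorsPrime = pr ∷ _ } =
  p , pr , subst (p ∣_) (sym eq) (m∣m*n _)

prime∣prime⇒≡ : ∀ {p q} → Prime p → Prime q → p ∣ q → p ≡ q
prime∣prime⇒≡ p-prime q-prime p∣q with prime⇒irreducible q-prime p∣q
... | inj₁ refl = contradiction p-prime ¬prime[1]
... | inj₂ p≡q  = p≡q

distinctPrimes⇒coprime : ∀ {p q} → Prime p → Prime q → p ≢ q → Coprime p q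
distinctPrimes⇒coprime p-prime q-prime p≢q (d∣p , d∣q) with prime⇒irreducible p-prime d∣p
... | inj₁ d≡1  = d≡1
... | inj₂ refl = contradiction (prime∣prime⇒≡ p-prime q-prime d∣q) p≢q

prime∣power⇒≡ : ∀ {p q} → Prime p → Prime q → ∀ k → p ∣ q ^ k → p ≡ q
prime∣power⇒≡ p-prime q-prime zero p∣1 = contradiction (subst Prime (∣1⇒≡1 p∣1) p-prime) ¬prime[1]
prime∣power⇒≡ {p} {q} p-prime q-prime (suc k) p∣ with euclidsLemma q (q ^ k) p-prime p∣
... | inj₁ p∣q  = prime∣prime⇒≡ p-prime q-prime p∣q
... | inj₂ p∣qᵏ = prime∣power⇒≡ p-prime q-prime k p∣qᵏ

splitPrimePower : ∀ {p} → Prime p → ∀ n → .{{NonZero n}} → ∃[ a ] ∃[ w ] n ≡ p ^ a * w × ¬ p ∣ w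
splitPrimePower {p} p-prime n = go n (ℕ.<-wellFounded n)
  where
  go : ∀ n → Acc _<_ n → .{{NonZero n}} → ∃[ a ] ∃[ w ] n ≡ p ^ a * w × ¬ p ∣ w
  go n (acc rec) with p ∣? n
  ... | no p∤n = 0 , n , sym (ℕ.+-identityʳ n) , p∤n
  ... | yes (divides m refl) =
    let instance m≢0 = ℕ.m*n≢0⇒m≢0 m
        a , w , eq , p∤w = go m (rec (ℕ.m<m*n m p (ℕ.nonTrivial⇒n>1 p {{prime⇒nonTrivial p-prime}})))
    in suc a , w , trans (cong (_* p) eq) (regroup (p ^ a) w p) , p∤w
    where
    regroup : ∀ q w p → q * w * p ≡ p * q * w
    regroup = solve-∀

-- A prime p ≠ r does not divide a power of r, so each factor p sits in the cofactor u and can be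
-- taken out of it.
evenValuation-cancel : ∀ {p r} → Prime p → Prime r → p ≢ r → ∀ k m → EvenValuation r (p ^ k * m) →
                       EvenValuation r m
evenValuation-cancel p-prime r-prime p≢r zero m h = subst (EvenValuation _) (ℕ.+-identityʳ m) h
evenValuation-cancel {p} {r} p-prime r-prime p≢r (suc k) m (s , u , eq , r∤u) =
  evenValuation-cancel p-prime r-prime p≢r k m
    (s , u′ , ℕ.*-cancelˡ-≡ _ _ p {{prime⇒nonZero p-prime}} (begin
      p * (p ^ k * m)            ≡⟨ ℕ.*-assoc p (p ^ k) m ⟨
      p ^ suc k * m              ≡⟨ eq ⟩
      r ^ s * r ^ s * u          ≡⟨ cong (r ^ s * r ^ s *_) u≡ ⟩
      r ^ s * r ^ s * (u′ * p)   ≡⟨ regroup (r ^ s) u′ p ⟩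
      p * (r ^ s * r ^ s * u′)   ∎) , λ r∣u′ → r∤u (subst (r ∣_) (sym u≡) (∣-trans r∣u′ (m∣m*n p))))
  where
  regroup : ∀ q u p → q * q * (u * p) ≡ p * (q * q * u)
  regroup = solve-∀
  p∣u : p ∣ u
  p∣u with euclidsLemma (r ^ s * r ^ s) u p-prime (subst (p ∣_) (trans (sym (ℕ.*-assoc p (p ^ k) m)) eq) (m∣m*n _))
  ... | inj₂ h = h
  ... | inj₁ h = contradiction
    ([ prime∣power⇒≡ p-prime r-prime s , prime∣power⇒≡ p-prime r-prime s ]′
      (euclidsLemma (r ^ s) (r ^ s) p-prime h)) p≢r
  u′ = _∣_.quotient p∣u
  u≡ : u ≡ u′ * p
  u≡ = _∣_.equality p∣u

-- Doubly negated, because the hypothesis will only be available in that form.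
evenValuations⇒square : ∀ n → .{{NonZero n}} → (∀ {p} → Prime p → p ∣ n → ¬ ¬ EvenValuation p n) →
                        ¬ ¬ (∃[ s ] n ≡ s * s)
evenValuations⇒square n = go n (ℕ.<-wellFounded n)
  where
  go : ∀ n → Acc _<_ n → .{{NonZero n}} → (∀ {p} → Prime p → p ∣ n → ¬ ¬ EvenValuation p n) →
       ¬ ¬ (∃[ s ] n ≡ s * s)
  go n (acc rec) even ¬square with n ℕ.≟ 1
  ... | yes refl = ¬square (1 , refl)
  ... | no n≢1 with p , p-prime , p∣n ← primeDivisor n n≢1 = even p-prime p∣n λ
    { (zero , u , n≡ , p∤u) → p∤u (subst (p ∣_) (trans n≡ (ℕ.+-identityʳ u)) p∣n)
    ; (suc s , u , n≡ , p∤u) →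
      let q = p ^ suc s
          instance u≢0 : NonZero u
                   u≢0 = ℕ.≢-nonZero λ { refl → p∤u (divides 0 refl) }
          instance p≢0 = prime⇒nonZero p-prime
          1<p = ℕ.nonTrivial⇒n>1 p {{prime⇒nonTrivial p-prime}}
          1<q = ℕ.<-≤-trans 1<p (ℕ.m≤m*n p (p ^ s) {{ℕ.m^n≢0 p s}})
          1<qq = ℕ.<-≤-trans 1<q (ℕ.m≤m*n q q {{ℕ.m^n≢0 p (suc s)}})
          u<n = subst (u <_) (sym (trans n≡ (ℕ.*-comm (q * q) u))) (ℕ.m<m*n u (q * q) 1<qq)
          n≡′ = trans n≡ (cong (_* u) (sym (ℕ.^-distribˡ-+-* p (suc s) (suc s))))
      in go u (rec u<n)
        -- The hypothesis passes to u: a prime r ∣ u differs from p, as p ∤ u, so removing the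
        -- p-part of n leaves the exponent of r unchanged.
        (λ {r} r-prime r∣u ¬even → even r-prime (subst (r ∣_) (sym n≡) (∣-trans r∣u (n∣m*n (q * q)))) λ ev →
          ¬even (evenValuation-cancel p-prime r-prime (λ { refl → p∤u r∣u }) (suc s + suc s) u
            (subst (EvenValuation r) n≡′ ev)))
        λ (w , u≡) → ¬square (q * w , trans n≡ (trans (cong (q * q *_) u≡) (regroup q w)))
    }
    where
    regroup : ∀ q w → q * q * (w * w) ≡ q * w * (q * w)
    regroup = solve-∀

-- Squares are 0 or 1 modulo 4, so an equality would leave 4 ∣ 3 or 4 ∣ 2.
square≢3+4l : ∀ s l → 3 + 4 * l ≢ s * s
square≢3+4l s l eq with parity s
  where
  parity : ∀ s → ∃[ k ] (s ≡ 2 * k ⊎ s ≡ 1 + 2 * k)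
  parity zero = 0 , inj₁ refl
  parity (suc s) with parity s
  ... | k , inj₁ refl = k , inj₂ refl
  ... | k , inj₂ refl = suc k , inj₁ (sym (ℕ.*-suc 2 k))
... | k , inj₁ refl = contradiction
  (∣m+n∣m⇒∣n (subst (4 ∣_) (sym (trans (ℕ.+-comm (4 * l) 3) (trans eq (even² k)))) (m∣m*n (k * k))) (m∣m*n l))
  (>⇒∤ (s≤s (s≤s (s≤s (s≤s z≤n)))))
  where
  even² : ∀ k → (2 * k) * (2 * k) ≡ 4 * (k * k)
  even² = solve-∀
... | k , inj₂ refl = contradiction
  (∣m+n∣m⇒∣n (subst (4 ∣_) (sym (trans (ℕ.+-comm (4 * l) 2) (ℕ.suc-injective (trans eq (odd² k))))) (m∣m*n (k * k + k)))
    (m∣m*n l))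
  (>⇒∤ (s≤s (s≤s (s≤s z≤n))))
  where
  odd² : ∀ k → (1 + 2 * k) * (1 + 2 * k) ≡ suc (4 * (k * k + k))
  odd² = solve-∀

-- The maximum of finitely many bounds will do; this supplies the principle `uniform` for `Fin v`.
uniformBound : ∀ {v} {P : ℕ → Pred (Fin v) 0ℓ} → (∀ {i j x} → i ≤ j → P i x → P j x) →
               (∀ x → ∃[ j ] P j x) → ∃[ j ] (∀ x → P j x)
uniformBound {zero} mono h = 0 , λ ()
uniformBound {suc v} {P} mono h with h zero | uniformBound {v} {λ j → P j ∘ suc} mono (h ∘ suc)
... | i , p₀ | j , p = i ⊔ j , λ { zero → mono (ℕ.m≤m⊔n i j) p₀ ; (suc x) → mono (ℕ.m≤n⊔m i j) (p x) }

-- Nilpotent groups and the conclusion.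

module _ {c ℓ} (G : Group c ℓ) where
  private module G = Group G

  UpperCentral-respects : ∀ i → UpperCentral G i Respects G._≈_
  UpperCentral-respects zero    x≈y (base x≈ε) = base (G.trans (G.sym x≈y) x≈ε)
  UpperCentral-respects (suc i) x≈y (step h) = step λ z →
    UpperCentral-respects i (G.∙-cong (G.∙-congʳ (G.⁻¹-cong x≈y)) (G.∙-congʳ x≈y)) (h z)

module _ {c ℓ n} (G : Group c ℓ) (order : HasOrder G n) where
  private
    module G = Group G
    F = finGroup G order
    open Enumeration order

  finGroup-upperCentral : ∀ i {x} → UpperCentral G i (from x) → UpperCentral (FinGroup.group F) i x
  finGroup-upperCentral zero    (base x≈ε) = base (trans (sym (to-from _)) (to-cong x≈ε))
  finGroup-upperCentral (suc i) (step h) = step λ y → finGroup-upperCentral i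
    (UpperCentral-respects G i
      (G.sym (G.trans (from-to _) (G.∙-cong (G.trans (from-to _) (G.∙-cong (from-to _) (from-to _))) (from-to _))))
      (h (from y)))

  finGroup-nilpotent : IsNilpotent G → IsNilpotent (FinGroup.group F)
  finGroup-nilpotent (i , nil) = i , λ x → finGroup-upperCentral i (nil (from x))

module _ {n} (G : Group 0ℓ 0ℓ) (order : HasOrder G n) where
  private
    module G = Group G
    F = finGroup G order
    open Enumeration order

  from-power : ∀ k x → from (power (FinGroup.group F) k x) G.≈ power G k (from x)
  from-power zero    x = from-to G.ε
  from-power (suc k) x = G.trans (from-to _) (G.∙-congˡ (from-power k x))

-- Double negation commutes with finite conjunctions, so while a contradiction is being derived a
-- predicate on `Fin n` may be taken as decidable.
¬¬-decidable : ∀ {n} (P : Pred (Fin n) 0ℓ) → ¬ ¬ (∀ x → Dec (P x))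
¬¬-decidable P = Fin.sequence (RawMonad.rawApplicative ¬¬-Monad) (λ x → ¬¬-excluded-middle)

module _ {v} (F : FinGroup v) (f : Fin v → ℤ.ℤ) .{{_ : NonZero v}}
  (f*f : ∀ g → FinGroup.selfConvolution F f g ≡ ℤ.1ℤ ℤ.- ℤ.+ v ℤ.* δ F g) where
  open FinGroup F
  open NormalSubgroup

  quotient-evenValuation : ∀ {r} → Prime r → (N : NormalSubgroup group) → (∀ x → Dec (Mem N x)) →
    (∀ x y → Mem N (x ∙ y ∙ (y ∙ x) ⁻¹)) → (∀ {x} → Mem N (power group r x) → Mem N x) → ¬ (∀ x → Mem N x) →
    EvenValuation r v
  quotient-evenValuation {r} r-prime N mem? abelian torsionFree proper = result
    where
    Q = group / N
    module Q = Group Q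
    finite : ∃[ n ] HasOrder Q n
    -- Deciding membership in N decides equality in the quotient, which is what its enumeration
    -- requires.
    finite = surjection⇒finite Q.setoid (λ x y → mem? (x ∙ y ⁻¹)) id (λ x → x , Q.refl)
    n = proj₁ finite
    open Enumeration (proj₂ finite)
    A = finGroup Q (proj₂ finite)
    module A = FinGroup A
    A-commutative : Commutative A
    A-commutative x y = to-cong (abelian (from x) (from y))
    A-torsionFree : ∀ {x} → power A.group r x ≡ A.ε → x ≡ A.ε
    A-torsionFree {x} rx = trans (sym (to-from x)) (to-cong (mem⇒≈ε N (torsionFree (≈ε⇒mem N
      (Q.trans (Q.sym (from-power Q (proj₂ finite) r x)) (Q.trans (Q.reflexive (cong from rx)) (from-to ε)))))))
    homo : ∀ x y → to (x ∙ y) ≡ to x A.∙ to y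
    homo x y = to-cong (Q.∙-cong (Q.sym (from-to x)) (Q.sym (from-to y)))
    surjective : ∀ a → ∃[ x ] to x ≡ a
    surjective a = from a , to-from a
    outside : ∃[ x ] ¬ Mem N x
    outside = Fin.¬∀⟶∃¬ v (Mem N) mem? proper
    nontrivial : to (proj₁ outside) ≢ A.ε
    nontrivial eq = proj₂ outside (≈ε⇒mem N (to-injective eq))
    -- Hence v = n m and m contain r to the same power.
    r∤n : ¬ r ∣ n
    r∤n r∣n with u , u≢ε , ru ← cauchy A r-prime r∣n = u≢ε (A-torsionFree ru)
    regroup : ∀ n q u → n * (q * q * u) ≡ q * q * (n * u)
    regroup = solve-∀
    scale : ∀ {m} → v ≡ n * m → EvenValuation r m → EvenValuation r v
    scale v≡ (s , u , m≡ , r∤u) =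
      s , n * u , trans v≡ (trans (cong (n *_) m≡) (regroup n (r ^ s) u))
        , λ r∣nu → [ r∤n , r∤u ]′ (euclidsLemma n u r-prime r∣nu)
    result : EvenValuation r v
    result =
      let m , v≡ , fibre≡ = fibreSize F A to homo surjective
      in scale v≡ (descent A r-prime A-commutative A-torsionFree nontrivial m
             {{ℕ.≢-nonZero λ m≡0 → ℕ.≢-nonZero⁻¹ v (trans v≡ (trans (cong (n *_) m≡0) (ℕ.*-zeroʳ n)))}}
             (pushforward F A to homo surjective f)
             (λ c → trans (pushforward-shds F A to homo surjective f*f c)
               (cong₂ (λ a b → a ℤ.- ℤ.+ b ℤ.* indicator (c Fin.≟ A.ε)) (fibre≡ c) v≡)))

  -- The prime q provides, by Cauchy's theorem, an element of order q; it survives the removal of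
  -- r-torsion and so keeps the quotient nontrivial.
  nilpotent-evenValuation : IsNilpotent group → ∀ {q r} → Prime q → Prime r → q ≢ r → q ∣ v →
                            ¬ ¬ EvenValuation r v
  nilpotent-evenValuation nil q-prime r-prime q≢r q∣v ¬even with u , u≢ε , qu ← cauchy F q-prime q∣v =
    abelianQuotient group nil uniformBound (distinctPrimes⇒coprime q-prime r-prime q≢r) u≢ε qu
      λ (N , abelian , torsionFree , proper) → ¬¬-decidable (Mem N)
        λ mem? → ¬even (quotient-evenValuation r-prime N mem? abelian torsionFree proper)

corollary2p8 : ∀ {c ℓ d} (G : Group c ℓ) →
    IsFinite G → IsNilpotent G → AdmitsSHDS G d →
    ∃[ p ] (Prime p × IsFinitePGroup G p)
corollary2p8 G _ nil (D , shds) with v , k , l , ds ← IsSkewHadamard.differenceSet shds = cases v ds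
  where
  cases : ∀ v {k l} → IsDifferenceSet G D v k l → ∃[ p ] (Prime p × IsFinitePGroup G p)
  cases zero ds with () ← Enumeration.to (IsDifferenceSet.order ds) (Group.ε G)
  -- The trivial group has order p⁰ for any prime p, here 2. It is set apart because the empty set
  -- is an SHDS in it, while v ≡ 3 (mod 4) fails.
  cases (suc zero) ds = 2 , prime[2] , 0 , IsDifferenceSet.order ds
  cases v@(suc (suc _)) {l = l} ds
    with p , p-prime , p∣v ← primeDivisor v (λ ())
    with a , w , v≡ , p∤w ← splitPrimePower p-prime v
    with w ℕ.≟ 1
  ... | yes refl = p , p-prime , a , subst (HasOrder G) (trans v≡ (ℕ.*-identityʳ (p ^ a))) (IsDifferenceSet.order ds)
  ... | no w≢1
    with q , q-prime , q∣w ← primeDivisor w {{ℕ.≢-nonZero λ { refl → p∤w (divides 0 refl) }}} w≢1 =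
    contradiction (λ (s , v≡s²) → square≢3+4l s l (trans (sym v≡3+4l) v≡s²)) (evenValuations⇒square v even)
    where
    open SkewHadamard G shds ds
    q∣v : q ∣ v
    q∣v = subst (q ∣_) (sym v≡) (∣-trans q∣w (n∣m*n (p ^ a)))
    v≡3+4l : v ≡ 3 + 4 * l
    v≡3+4l = skewHadamard-order F signature signature-odd signature-square {l = l} (s≤s (s≤s z≤n)) doubled-balanced
    f*f : ∀ g → FinGroup.selfConvolution F signature g ≡ ℤ.1ℤ ℤ.- ℤ.+ v ℤ.* δ F g
    f*f = skewHadamard-convolution F signature signature-odd signature-square {l = l} (s≤s (s≤s z≤n)) doubled-balanced
    even′ : ∀ {q r} → Prime q → Prime r → q ≢ r → q ∣ v → ¬ ¬ EvenValuation r v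
    even′ = nilpotent-evenValuation F signature f*f (finGroup-nilpotent G (IsDifferenceSet.order ds) nil)
    even : ∀ {r} → Prime r → r ∣ v → ¬ ¬ EvenValuation r v
    -- A prime divisor of v other than r is called for: p itself unless r = p, and q in that case,
    -- which differs from p because q ∣ w and p ∤ w.
    even {r} r-prime _ with p ℕ.≟ r
    ... | no p≢r   = even′ p-prime r-prime p≢r p∣v
    ... | yes refl = even′ q-prime r-prime (λ { refl → p∤w q∣w }) q∣v
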